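{- For any graph $G$ of order $n$ with maximum vertex degree $\Delta$, $$ L_k(G)\;>\;\frac{k\,n}{e\,(1+\Delta)^{1+1/k}}, $$ where $e$ is the base of the natural logarithm.
   Context: Graphs are simple and undirected. $k$ is a positive integer. $N[v]$ denotes the closed neighbourhood of a vertex $v$ (the vertex $v$ together with all its neighbours). A vertex set $X\subseteq V(G)$ is a $k$-limited packing of $G$ if $|N[v]\cap X|\le k$ for every vertex $v\in V(G)$. The $k$-limited packing number $L_k(G)$ is the maximum size of a $k$-limited packing in $G$.
   Formalization: The condition k ≤ 1+Δ is added (and G has a vertex): without it the inequality fails, e.g. for the one-vertex graph with k = 3, where L_3 = 1 < 3/e; for k > 1+Δ every vertex set is a k-limited packing and L_k(G) = n. -}

module Defs where

open import Data.Empty using (⊥-elim)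
open import Data.Fin.Base using (Fin)
open import Data.Fin.Properties using (all?)
open import Data.Fin.Subset using (Subset; ∣_∣; _∩_; _∪_; ⁅_⁆; ⊥)
open import Data.Fin.Subset.Properties using (anySubset?; ∣p∣≤n; ∣⊥∣≡0; ∩-zeroʳ)
open import Data.Integer.Base as ℤ using (+_)
import Data.Integer.Properties as ℤ
open import Data.Nat.Base as ℕ using (ℕ; zero; suc; z≤n; s≤s; NonZero; _!)
import Data.Nat.Properties as ℕ
open import Data.Nat.Tactic.RingSolver using (solve-∀)
open import Data.Product.Base using (∃; ∃-syntax; _×_; _,_; proj₁; proj₂)
open import Data.Rational.Base as ℚ
  using (ℚ; mkℚ; 0ℚ; 1ℚ; ½; _/_; _+_; _-_; -_; _*_; 1/_; _≤_; _<_)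
import Data.Rational.Properties as ℚ
open import Data.Rational.Solver using (module +-*-Solver)
import Data.Rational.Unnormalised.Base as ℚᵘ
import Data.Rational.Unnormalised.Properties as ℚᵘ
open import Data.Sum.Base using (inj₁; inj₂)
open import Data.Vec.Base using (tabulate)
open import Function.Base using (_∘_)
open import Level using (0ℓ)
open import Relation.Binary.Core using (Rel)
open import Relation.Binary.Definitions using (Decidable; Symmetric; Irreflexive)
open import Relation.Binary.PropositionalEquality
  using (_≡_; refl; sym; trans; cong; cong₂; subst; subst₂)
open import Relation.Nullary.Decidable using (yes; no; does; _×-dec_)
open import Relation.Unary using (Pred)
import Relation.Unary as Unary

IsMaximum : Pred ℕ 0ℓ → ℕ → Set
IsMaximum P m = P m × (∀ {j} → P j → j ℕ.≤ m)

maximum : ∀ {P : Pred ℕ 0ℓ} → Unary.Decidable P → P 0 →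
          ∀ b → (∀ {j} → P j → j ℕ.≤ b) → ∃ (IsMaximum P)
maximum P? p₀ zero    ub = 0 , p₀ , ub
maximum P? p₀ (suc b) ub with P? (suc b)
... | yes p = suc b , p , ub
... | no ¬p = maximum P? p₀ b λ {j} pj →
  ℕ.≤-pred (ℕ.≤∧≢⇒< (ub pj) λ { refl → ¬p pj })

record SimpleGraph (n : ℕ) : Set₁ where
  field
    Adj    : Rel (Fin n) 0ℓ
    adj?   : Decidable Adj
    symm   : Symmetric Adj
    irrefl : Irreflexive _≡_ Adj

  neighbours : Fin n → Subset n
  neighbours v = tabulate (does ∘ adj? v)

  N[_] : Fin n → Subset n
  N[ v ] = ⁅ v ⁆ ∪ neighbours v

  degree : Fin n → ℕ
  degree v = ∣ neighbours v ∣

open SimpleGraph public using (N[_]; degree)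

-- An attained maximum: this forces the graph to have a vertex.
HasMaxDegree : ∀ {n} → SimpleGraph n → ℕ → Set
HasMaxDegree G = IsMaximum λ d → ∃[ v ] degree G v ≡ d

IsLimitedPacking : ∀ {n} → ℕ → SimpleGraph n → Subset n → Set
IsLimitedPacking k G X = ∀ v → ∣ N[_] G v ∩ X ∣ ℕ.≤ k

HasLimitedPackingOfSize : ∀ {n} → ℕ → SimpleGraph n → ℕ → Set
HasLimitedPackingOfSize k G m = ∃[ X ] IsLimitedPacking k G X × ∣ X ∣ ≡ m

limitedPackingNumber : ∀ {n} k (G : SimpleGraph n) →
                       ∃ (IsMaximum (HasLimitedPackingOfSize k G))
limitedPackingNumber {n} k G = maximum
  (λ m → anySubset? λ X → all? (λ v → _ ℕ.≤? k) ×-dec (∣ X ∣ ℕ.≟ m))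
  (⊥ , (λ v → subst (ℕ._≤ k) (sym (empty v)) z≤n) , ∣⊥∣≡0 n)
  n (λ (X , _ , eq) → subst (ℕ._≤ n) eq (∣p∣≤n X))
  where
  empty : ∀ v → ∣ N[_] G v ∩ ⊥ ∣ ≡ 0
  empty v = trans (cong ∣_∣ (∩-zeroʳ (N[_] G v))) (∣⊥∣≡0 n)

L : ∀ {n} → ℕ → SimpleGraph n → ℕ
L k G = proj₁ (limitedPackingNumber k G)

Cauchy : (ℕ → ℚ) → Set
Cauchy x = ∀ ε → 0ℚ < ε →
  ∃[ N ] ∀ {m n} → N ℕ.≤ m → N ℕ.≤ n → ℚ.∣ x m - x n ∣ < ε

record ℝ : Set where
  constructor real
  field
    seq    : ℕ → ℚ
    cauchy : Cauchy seq
open ℝ public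

-- Strict: the sequences eventually differ by a fixed positive rational.
infix 4 _<ℝ_

record _<ℝ_ (x y : ℝ) : Set where
  field
    ε   : ℚ
    0<ε : 0ℚ < ε
    N   : ℕ
    gap : ∀ {m} → N ℕ.≤ m → seq x m + ε ≤ seq y m

∣p-p∣≡0 : ∀ p → ℚ.∣ p - p ∣ ≡ 0ℚ
∣p-p∣≡0 p = cong ℚ.∣_∣ (ℚ.+-inverseʳ p)

fromℚ : ℚ → ℝ
fromℚ q = real (λ _ → q) λ ε 0<ε →
  0 , λ _ _ → subst (_< ε) (sym (∣p-p∣≡0 q)) 0<ε

fromℕ : ℕ → ℝ
fromℕ n = fromℚ (+ n / 1)

module _ where
  open +-*-Solver

  *-expand : ∀ a b c d → a * b - c * d ≡ a * (b - d) + d * (a - c)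
  *-expand = solve 4 (λ a b c d →
    a :* b :- c :* d := a :* (b :- d) :+ d :* (a :- c)) refl

  cancel-+ : ∀ p q → (p - q) + q ≡ p
  cancel-+ = solve 2 (λ p q → (p :- q) :+ q := p) refl

  neg-- : ∀ p q → - (p - q) ≡ q - p
  neg-- = solve 2 (λ p q → :- (p :- q) := q :- p) refl

  +-cancel : ∀ p q → (p + q) - p ≡ q
  +-cancel = solve 2 (λ p q → (p :+ q) :- p := q) refl

  1/-diff : ∀ a b r s → a * r ≡ 1ℚ → b * s ≡ 1ℚ → r - s ≡ (b - a) * (r * s)
  1/-diff a b r s ar bs = trans
    (cong₂ _-_ (trans (sym (ℚ.*-identityˡ r)) (cong (_* r) (sym bs)))
               (trans (sym (ℚ.*-identityˡ s)) (cong (_* s) (sym ar))))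
    (solve 4 (λ a b r s →
      b :* s :* r :- a :* r :* s := (b :- a) :* (r :* s)) refl a b r s)

  halves : ∀ p → p * ½ + p * ½ ≡ p
  halves = solve 1 (λ p → p :* con ½ :+ p :* con ½ := p) refl

∣p-q∣≡∣q-p∣ : ∀ p q → ℚ.∣ p - q ∣ ≡ ℚ.∣ q - p ∣
∣p-q∣≡∣q-p∣ p q = trans (sym (ℚ.∣-p∣≡∣p∣ (p - q))) (cong ℚ.∣_∣ (neg-- p q))

p≤q+r⇒p-q≤r : ∀ {p q r} → p ≤ q + r → p - q ≤ r
p≤q+r⇒p-q≤r {p} {q} {r} h =
  subst (p - q ≤_) (+-cancel q r) (ℚ.+-monoˡ-≤ (- q) h)

∣p-q∣≤ : ∀ {p q r} → p ≤ q + r → q ≤ p + r → ℚ.∣ p - q ∣ ≤ r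
∣p-q∣≤ {p} {q} p≤ q≤ with ℚ.∣p∣≡p∨∣p∣≡-p (p - q)
... | inj₁ eq = subst (_≤ _) (sym eq) (p≤q+r⇒p-q≤r p≤)
... | inj₂ eq = subst (_≤ _) (sym (trans eq (neg-- p q))) (p≤q+r⇒p-q≤r q≤)

*-mono-≤-nonNeg : ∀ {p q r s} → 0ℚ ≤ r → 0ℚ ≤ q → p ≤ q → r ≤ s → p * r ≤ q * s
*-mono-≤-nonNeg {p} {q} {r} {s} 0≤r 0≤q p≤q r≤s = ℚ.≤-trans
  (ℚ.*-monoʳ-≤-nonNeg r {{ℚ.nonNegative 0≤r}} p≤q)
  (ℚ.*-monoˡ-≤-nonNeg q {{ℚ.nonNegative 0≤q}} r≤s)

*-pos : ∀ {p q} → 0ℚ < p → 0ℚ < q → 0ℚ < p * q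
*-pos {p} {q} 0<p 0<q = ℚ.positive⁻¹ (p * q)
  {{ℚ.pos*pos⇒pos p {{ℚ.positive 0<p}} q {{ℚ.positive 0<q}}}}

halve : ∀ ε → 0ℚ < ε → ∃[ η ] 0ℚ < η × η + η ≡ ε
halve ε 0<ε = ε * ½ , *-pos {ε} {½} 0<ε (ℚ.positive⁻¹ ½) , halves ε

-- Total, with the junk value 0 at 0, so that the sequence of x ⁻¹ below does
-- not depend on the proof that x is positive.
recip : ℚ → ℚ
recip q with q ℚ.≟ 0ℚ
... | yes _  = 0ℚ
... | no q≢0 = (1/ q) {{ℚ.≢-nonZero q≢0}}

module _ {q : ℚ} (0<q : 0ℚ < q) where

  recip-inverseʳ : q * recip q ≡ 1ℚ
  recip-inverseʳ with q ℚ.≟ 0ℚ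
  ... | yes q≡0 = ⊥-elim (ℚ.<-irrefl (sym q≡0) 0<q)
  ... | no q≢0  = ℚ.*-inverseʳ q {{ℚ.≢-nonZero q≢0}}

  0<recip : 0ℚ < recip q
  0<recip = ℚ.*-cancelˡ-<-nonNeg q {{ℚ.nonNegative (ℚ.<⇒≤ 0<q)}}
    (subst₂ _<_ (sym (ℚ.*-zeroʳ q)) (sym recip-inverseʳ) (ℚ.positive⁻¹ 1ℚ))

recip-anti : ∀ {p q} → 0ℚ < p → p ≤ q → recip q ≤ recip p
recip-anti {p} {q} 0<p p≤q =
  ℚ.*-cancelˡ-≤-pos q {{ℚ.positive 0<q}} (begin
    q * recip q  ≡⟨ recip-inverseʳ 0<q ⟩
    1ℚ           ≡⟨ recip-inverseʳ 0<p ⟨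
    p * recip p  ≤⟨ ℚ.*-monoʳ-≤-nonNeg (recip p)
                      {{ℚ.nonNegative (ℚ.<⇒≤ (0<recip 0<p))}} p≤q ⟩
    q * recip p  ∎)
  where
  open ℚ.≤-Reasoning
  0<q = ℚ.<-≤-trans 0<p p≤q

/-toℚᵘ : ∀ a b .{{_ : NonZero b}} → ℚ.toℚᵘ (+ a / b) ℚᵘ.≃ (+ a ℚᵘ./ b)
/-toℚᵘ a (suc b) = ℚ.toℚᵘ-fromℚᵘ (ℚᵘ.mkℚᵘ (+ a) b)

/-mono-≤ : ∀ a b c d .{{_ : NonZero b}} .{{_ : NonZero d}} →
           a ℕ.* d ℕ.≤ c ℕ.* b → + a / b ≤ + c / d
/-mono-≤ a b@(suc _) c d@(suc _) h = ℚ.toℚᵘ-cancel-≤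
  (ℚᵘ.≤-respˡ-≃ (ℚᵘ.≃-sym (/-toℚᵘ a b))
  (ℚᵘ.≤-respʳ-≃ (ℚᵘ.≃-sym (/-toℚᵘ c d))
  (ℚᵘ.*≤* (subst₂ ℤ._≤_ (ℤ.pos-* a d) (ℤ.pos-* c b) (ℤ.+≤+ h)))))

/-+ : ∀ a b c d .{{_ : NonZero b}} .{{_ : NonZero d}} .{{_ : NonZero (b ℕ.* d)}} →
      (+ a / b) + (+ c / d) ≡ + (a ℕ.* d ℕ.+ c ℕ.* b) / (b ℕ.* d)
/-+ a b@(suc _) c d@(suc _) = ℚ.toℚᵘ-injective
  (ℚᵘ.≃-trans (ℚ.toℚᵘ-homo-+ (+ a / b) (+ c / d))
  (ℚᵘ.≃-trans (ℚᵘ.+-cong (/-toℚᵘ a b) (/-toℚᵘ c d))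
  (ℚᵘ.≃-trans (ℚᵘ.≃-reflexive (cong (ℚᵘ._/ (b ℕ.* d)) num))
  (ℚᵘ.≃-sym (/-toℚᵘ _ (b ℕ.* d))))))
  where
  num : + a ℤ.* + d ℤ.+ + c ℤ.* + b ≡ + (a ℕ.* d ℕ.+ c ℕ.* b)
  num = trans (cong₂ ℤ._+_ (sym (ℤ.pos-* a d)) (sym (ℤ.pos-* c b)))
              (sym (ℤ.pos-+ (a ℕ.* d) (c ℕ.* b)))

archimedean : ∀ ε → 0ℚ < ε → ∃[ N ] + 1 / suc N < ε
archimedean ε 0<ε = go ε (ℚ.positive 0<ε)
  where
  go : ∀ ε → ℚ.Positive ε → ∃[ N ] + 1 / suc N < ε
  go ε@(mkℚ (+ suc a) d-1 _) _ = suc d-1 , ℚ.toℚᵘ-cancel-<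
    (ℚᵘ.<-respˡ-≃ (ℚᵘ.≃-sym (/-toℚᵘ 1 (suc (suc d-1))))
    (ℚᵘ.*<* (subst₂ ℤ._<_ (ℤ.pos-* 1 (suc d-1)) (ℤ.pos-* (suc a) (suc (suc d-1)))
      (ℤ.+<+ (ℕ.≤-trans
        (s≤s (ℕ.≤-reflexive (ℕ.+-identityʳ (suc d-1))))
        (ℕ.m≤m+n (suc (suc d-1)) (a ℕ.* suc (suc d-1))))))))

cauchyByRate : ∀ x →
  (∀ {N m n} → N ℕ.< m → N ℕ.< n → x m ≤ x n + + 1 / suc N) → Cauchy x
cauchyByRate x rate ε 0<ε with archimedean ε 0<ε
... | N , 1/N<ε = suc N , λ m> n> →
  ℚ.≤-<-trans (∣p-q∣≤ (rate m> n>) (rate n> m>)) 1/N<ε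

eventuallyBounded : ∀ {x} → Cauchy x →
  ∃[ M ] 0ℚ < M × ∃[ N ] (∀ {m} → N ℕ.≤ m → ℚ.∣ x m ∣ ≤ M)
eventuallyBounded {x} cx with cx 1ℚ (ℚ.positive⁻¹ 1ℚ)
... | N , close =
  1ℚ + ℚ.∣ x N ∣ ,
  ℚ.<-≤-trans (ℚ.positive⁻¹ 1ℚ)
    (subst (_≤ 1ℚ + ℚ.∣ x N ∣) (ℚ.+-identityʳ 1ℚ) (ℚ.+-monoʳ-≤ 1ℚ (ℚ.0≤∣p∣ (x N)))) ,
  N , λ {m} N≤m → begin
    ℚ.∣ x m ∣                        ≡⟨ cong ℚ.∣_∣ (cancel-+ (x m) (x N)) ⟨
    ℚ.∣ (x m - x N) + x N ∣          ≤⟨ ℚ.∣p+q∣≤∣p∣+∣q∣ (x m - x N) (x N) ⟩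
    ℚ.∣ x m - x N ∣ + ℚ.∣ x N ∣      ≤⟨ ℚ.+-monoˡ-≤ ℚ.∣ x N ∣ (ℚ.<⇒≤ (close N≤m ℕ.≤-refl)) ⟩
    1ℚ + ℚ.∣ x N ∣                   ∎
  where open ℚ.≤-Reasoning

scaledGap : ∀ {M ε u d} → 0ℚ < M → ℚ.∣ u ∣ ≤ M →
            ℚ.∣ d ∣ < ε * recip M → ℚ.∣ u * d ∣ < ε
scaledGap {M} {ε} {u} {d} 0<M u≤M d< = begin-strict
  ℚ.∣ u * d ∣          ≡⟨ ℚ.∣p*q∣≡∣p∣*∣q∣ u d ⟩
  ℚ.∣ u ∣ * ℚ.∣ d ∣    ≤⟨ ℚ.*-monoʳ-≤-nonNeg ℚ.∣ d ∣ {{ℚ.∣-∣-nonNeg d}} u≤M ⟩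
  M * ℚ.∣ d ∣          <⟨ ℚ.*-monoʳ-<-pos M {{ℚ.positive 0<M}} d< ⟩
  M * (ε * recip M)    ≡⟨ shuffle M ε (recip M) ⟩
  ε * (M * recip M)    ≡⟨ cong (ε *_) (recip-inverseʳ 0<M) ⟩
  ε * 1ℚ               ≡⟨ ℚ.*-identityʳ ε ⟩
  ε                    ∎
  where
  open ℚ.≤-Reasoning
  open +-*-Solver
  shuffle : ∀ a b c → a * (b * c) ≡ b * (a * c)
  shuffle = solve 3 (λ a b c → a :* (b :* c) := b :* (a :* c)) refl

*-cauchy : ∀ {x y} → Cauchy x → Cauchy y → Cauchy (λ m → x m * y m)
*-cauchy {x} {y} cx cy ε 0<ε = combine
  (eventuallyBounded {x} cx) (eventuallyBounded {y} cy) (halve ε 0<ε)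
  where
  open ℚ.≤-Reasoning
  combine : (∃[ A ] 0ℚ < A × ∃[ N ] (∀ {m} → N ℕ.≤ m → ℚ.∣ x m ∣ ≤ A)) →
            (∃[ B ] 0ℚ < B × ∃[ N ] (∀ {m} → N ℕ.≤ m → ℚ.∣ y m ∣ ≤ B)) →
            (∃[ η ] 0ℚ < η × η + η ≡ ε) →
            ∃[ N ] ∀ {m n} → N ℕ.≤ m → N ℕ.≤ n → ℚ.∣ x m * y m - x n * y n ∣ < ε
  combine (A , 0<A , N₁ , ∣x∣≤A) (B , 0<B , N₂ , ∣y∣≤B) (η , 0<η , η+η≡ε) =
    N , λ {m} {n} N≤m N≤n → begin-strict
      ℚ.∣ x m * y m - x n * y n ∣
        ≡⟨ cong ℚ.∣_∣ (*-expand (x m) (y m) (x n) (y n)) ⟩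
      ℚ.∣ x m * (y m - y n) + y n * (x m - x n) ∣
        ≤⟨ ℚ.∣p+q∣≤∣p∣+∣q∣ (x m * (y m - y n)) (y n * (x m - x n)) ⟩
      ℚ.∣ x m * (y m - y n) ∣ + ℚ.∣ y n * (x m - x n) ∣
        <⟨ ℚ.+-mono-<
             (scaledGap {A} {η} {x m} {y m - y n} 0<A (∣x∣≤A (ℕ.≤-trans N₁≤ N≤m))
               (proj₂ yMod (ℕ.≤-trans N₄≤ N≤m) (ℕ.≤-trans N₄≤ N≤n)))
             (scaledGap {B} {η} {y n} {x m - x n} 0<B (∣y∣≤B (ℕ.≤-trans N₂≤ N≤n))
               (proj₂ xMod (ℕ.≤-trans N₃≤ N≤m) (ℕ.≤-trans N₃≤ N≤n))) ⟩
      η + η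
        ≡⟨ η+η≡ε ⟩
      ε ∎
    where
    xMod = cx (η * recip B) (*-pos {η} {recip B} 0<η (0<recip {B} 0<B))
    yMod = cy (η * recip A) (*-pos {η} {recip A} 0<η (0<recip {A} 0<A))
    N₃ = proj₁ xMod
    N₄ = proj₁ yMod
    N = (N₁ ℕ.⊔ N₂) ℕ.⊔ (N₃ ℕ.⊔ N₄)
    N₁≤ : N₁ ℕ.≤ N
    N₁≤ = ℕ.≤-trans (ℕ.m≤m⊔n N₁ N₂) (ℕ.m≤m⊔n _ _)
    N₂≤ : N₂ ℕ.≤ N
    N₂≤ = ℕ.≤-trans (ℕ.m≤n⊔m N₁ N₂) (ℕ.m≤m⊔n _ _)
    N₃≤ : N₃ ℕ.≤ N
    N₃≤ = ℕ.≤-trans (ℕ.m≤m⊔n N₃ N₄) (ℕ.m≤n⊔m (N₁ ℕ.⊔ N₂) _)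
    N₄≤ : N₄ ℕ.≤ N
    N₄≤ = ℕ.≤-trans (ℕ.m≤n⊔m N₃ N₄) (ℕ.m≤n⊔m (N₁ ℕ.⊔ N₂) _)

recip-cauchy : ∀ {x δ N} → Cauchy x → 0ℚ < δ →
               (∀ {m} → N ℕ.≤ m → δ ≤ x m) → Cauchy (recip ∘ x)
recip-cauchy {x} {δ} {N₀} cx 0<δ δ≤x ε 0<ε = N₀ ℕ.⊔ N₁ , close
  where
  D = recip δ * recip δ
  0<D : 0ℚ < D
  0<D = *-pos {recip δ} {recip δ} (0<recip {δ} 0<δ) (0<recip {δ} 0<δ)
  modulus = cx (ε * recip D) (*-pos {ε} {recip D} 0<ε (0<recip {D} 0<D))
  N₁ = proj₁ modulus
  close : ∀ {m n} → N₀ ℕ.⊔ N₁ ℕ.≤ m → N₀ ℕ.⊔ N₁ ℕ.≤ n →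
          ℚ.∣ recip (x m) - recip (x n) ∣ < ε
  close {m} {n} N≤m N≤n = subst (_< ε) (sym (cong ℚ.∣_∣ eq))
    (scaledGap {D} {ε} {r * s} {x n - x m} 0<D
      (subst (_≤ D) (sym (ℚ.0≤p⇒∣p∣≡p (ℚ.<⇒≤ (*-pos {r} {s} 0<r 0<s)))) rs≤D)
      (proj₂ modulus (ℕ.≤-trans (ℕ.m≤n⊔m N₀ N₁) N≤n) (ℕ.≤-trans (ℕ.m≤n⊔m N₀ N₁) N≤m)))
    where
    r = recip (x m)
    s = recip (x n)
    δ≤m = δ≤x (ℕ.≤-trans (ℕ.m≤m⊔n N₀ N₁) N≤m)
    δ≤n = δ≤x (ℕ.≤-trans (ℕ.m≤m⊔n N₀ N₁) N≤n)
    0<m = ℚ.<-≤-trans 0<δ δ≤m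
    0<n = ℚ.<-≤-trans 0<δ δ≤n
    0<r = 0<recip {x m} 0<m
    0<s = 0<recip {x n} 0<n
    rs≤D : r * s ≤ D
    rs≤D = *-mono-≤-nonNeg {r} {recip δ} {s} {recip δ} (ℚ.<⇒≤ 0<s)
      (ℚ.<⇒≤ (0<recip {δ} 0<δ)) (recip-anti {δ} {x m} 0<δ δ≤m) (recip-anti {δ} {x n} 0<δ δ≤n)
    eq : r - s ≡ (r * s) * (x n - x m)
    eq = trans
      (1/-diff (x m) (x n) r s (recip-inverseʳ {x m} 0<m) (recip-inverseʳ {x n} 0<n))
      (ℚ.*-comm (x n - x m) (r * s))

0ℝ : ℝ
0ℝ = fromℕ 0

record ℝ⁺ : Set where
  constructor positiveReal
  field
    value    : ℝ
    positive : 0ℝ <ℝ value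

  open _<ℝ_ positive public

  lowerBound : ∀ {m} → N ℕ.≤ m → ε ≤ seq value m
  lowerBound {m} N≤m = subst (_≤ seq value m) (ℚ.+-identityˡ ε) (gap N≤m)
open ℝ⁺ public using (value; positive)

infixl 7 _*ℝ_ _*⁺_ _÷ℝ_

_*ℝ_ : ℝ → ℝ → ℝ
x *ℝ y = real (λ m → seq x m * seq y m) (*-cauchy {seq x} {seq y} (cauchy x) (cauchy y))

_*⁺_ : ℝ⁺ → ℝ⁺ → ℝ⁺
x *⁺ y = positiveReal (value x *ℝ value y) record
  { ε   = X.ε * Y.ε
  ; 0<ε = *-pos X.0<ε Y.0<ε
  ; N   = X.N ℕ.⊔ Y.N
  ; gap = λ {m} N≤m →
      let ≤x = X.lowerBound (ℕ.≤-trans (ℕ.m≤m⊔n X.N Y.N) N≤m)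
          ≤y = Y.lowerBound (ℕ.≤-trans (ℕ.m≤n⊔m X.N Y.N) N≤m)
      in subst (_≤ seq X.value m * seq Y.value m) (sym (ℚ.+-identityˡ (X.ε * Y.ε)))
           (*-mono-≤-nonNeg (ℚ.<⇒≤ Y.0<ε) (ℚ.≤-trans (ℚ.<⇒≤ X.0<ε) ≤x) ≤x ≤y)
  }
  where
  module X = ℝ⁺ x
  module Y = ℝ⁺ y

_⁻¹ : ℝ⁺ → ℝ
x ⁻¹ = real (recip ∘ seq X.value)
  (recip-cauchy {seq X.value} (cauchy X.value) X.0<ε X.lowerBound)
  where module X = ℝ⁺ x

_÷ℝ_ : ℝ → ℝ⁺ → ℝ
x ÷ℝ y = x *ℝ (y ⁻¹)

invFact : ℕ → ℚ
invFact i = (+ 1 / (i !)) {{ℕ._!≢0 i}}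

-- ∑_{i ≤ m} 1 / i!
eSum : ℕ → ℚ
eSum zero    = invFact 0
eSum (suc m) = eSum m + invFact (suc m)

0≤invFact : ∀ i → 0ℚ ≤ invFact i
0≤invFact i = /-mono-≤ 0 1 1 (i !) {{_}} {{ℕ._!≢0 i}} z≤n

invFact-halves : ∀ i → invFact (suc (suc i)) + invFact (suc (suc i)) ≤ invFact (suc i)
invFact-halves i = ℚ.≤-trans
  (ℚ.≤-reflexive (/-+ 1 b 1 b {{b≢0}} {{b≢0}} {{bb≢0}}))
  (/-mono-≤ (1 ℕ.* b ℕ.+ 1 ℕ.* b) (b ℕ.* b) 1 a {{bb≢0}} {{a≢0}} (begin
    (1 ℕ.* b ℕ.+ 1 ℕ.* b) ℕ.* a     ≡⟨ rearrange a b ⟩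
    1 ℕ.* (b ℕ.* (2 ℕ.* a))         ≤⟨ ℕ.*-monoʳ-≤ 1 (ℕ.*-monoʳ-≤ b
                                         (ℕ.*-monoˡ-≤ a {2} {suc (suc i)} (s≤s (s≤s z≤n)))) ⟩
    1 ℕ.* (b ℕ.* b)                 ∎))
  where
  open ℕ.≤-Reasoning
  a = suc i !
  b = suc (suc i) !
  a≢0 : NonZero a
  a≢0 = ℕ._!≢0 (suc i)
  b≢0 : NonZero b
  b≢0 = ℕ._!≢0 (suc (suc i))
  bb≢0 : NonZero (b ℕ.* b)
  bb≢0 = ℕ.m*n≢0 b b {{b≢0}} {{b≢0}}
  rearrange : ∀ a b → (1 ℕ.* b ℕ.+ 1 ℕ.* b) ℕ.* a ≡ 1 ℕ.* (b ℕ.* (2 ℕ.* a))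
  rearrange = solve-∀

eSum-mono : ∀ m j → eSum m ≤ eSum (j ℕ.+ m)
eSum-mono m zero    = ℚ.≤-refl
eSum-mono m (suc j) = ℚ.≤-trans (eSum-mono m j)
  (subst (_≤ eSum (suc j ℕ.+ m)) (ℚ.+-identityʳ (eSum (j ℕ.+ m)))
    (ℚ.+-monoʳ-≤ (eSum (j ℕ.+ m)) (0≤invFact (suc j ℕ.+ m))))

eSum-tail : ∀ m j → let n = j ℕ.+ suc m in
            eSum n + invFact n ≤ eSum (suc m) + invFact (suc m)
eSum-tail m zero    = ℚ.≤-refl
eSum-tail m (suc j) = ℚ.≤-trans step (eSum-tail m j)
  where
  step : (eSum (j ℕ.+ suc m) + invFact (suc (j ℕ.+ suc m))) + invFact (suc (j ℕ.+ suc m))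
         ≤ eSum (j ℕ.+ suc m) + invFact (j ℕ.+ suc m)
  step rewrite ℕ.+-suc j m = ℚ.≤-trans
    (ℚ.≤-reflexive (ℚ.+-assoc (eSum (suc (j ℕ.+ m))) _ _))
    (ℚ.+-monoʳ-≤ (eSum (suc (j ℕ.+ m))) (invFact-halves (j ℕ.+ m)))

eSum-rate : ∀ {N m n} → N ℕ.< m → N ℕ.< n → eSum m ≤ eSum n + + 1 / suc N
eSum-rate {N} {m} {suc n} _ (s≤s N≤n) = ℚ.≤-trans bound
  (ℚ.+-monoʳ-≤ (eSum (suc n)) (/-mono-≤ 1 (suc n !) 1 (suc N)
    {{ℕ._!≢0 (suc n)}} (ℕ.*-monoʳ-≤ 1 (ℕ.≤-trans (s≤s N≤n)
      (ℕ.m≤m*n (suc n) (n !) {{ℕ._!≢0 n}})))))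
  where
  weaken : ∀ {p} i → p ≤ p + invFact i
  weaken {p} i = subst (_≤ p + invFact i) (ℚ.+-identityʳ p) (ℚ.+-monoʳ-≤ p (0≤invFact i))
  bound : eSum m ≤ eSum (suc n) + invFact (suc n)
  bound with ℕ.≤-total m (suc n)
  ... | inj₁ m≤n = ℚ.≤-trans
    (subst (λ i → eSum m ≤ eSum i) (ℕ.m∸n+n≡m m≤n) (eSum-mono m (suc n ℕ.∸ m)))
    (weaken (suc n))
  ... | inj₂ n≤m = ℚ.≤-trans (weaken m)
    (subst (λ i → eSum i + invFact i ≤ eSum (suc n) + invFact (suc n))
      (ℕ.m∸n+n≡m n≤m) (eSum-tail n (m ℕ.∸ suc n)))

e : ℝ⁺
e = positiveReal (real eSum (cauchyByRate eSum eSum-rate)) record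
  { ε   = 1ℚ
  ; 0<ε = ℚ.positive⁻¹ 1ℚ
  ; N   = 0
  ; gap = λ {m} _ → subst (λ i → 1ℚ ≤ eSum i) (ℕ.+-identityʳ m) (eSum-mono 0 m)
  }

-- The least t ≤ b with x ≤ t ^ q, provided x ≤ b ^ q.
leastRoot : (q x b : ℕ) → ℕ
leastRoot q x zero    = zero
leastRoot q x (suc b) with x ℕ.≤? b ℕ.^ q
... | yes _ = leastRoot q x b
... | no  _ = suc b

leastRoot-upper : ∀ q x b → x ℕ.≤ b ℕ.^ q → x ℕ.≤ leastRoot q x b ℕ.^ q
leastRoot-upper q x zero    h = h
leastRoot-upper q x (suc b) h with x ℕ.≤? b ℕ.^ q
... | yes h′ = leastRoot-upper q x b h′
... | no  _  = h

leastRoot-least : ∀ q x b {t} → leastRoot q x b ≡ suc t → t ℕ.^ q ℕ.< x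
leastRoot-least q x (suc b) eq   with x ℕ.≤? b ℕ.^ q
leastRoot-least q x (suc b) eq   | yes _ = leastRoot-least q x b eq
leastRoot-least q x (suc b) refl | no ¬h = ℕ.≰⇒> ¬h

-- ⌈ x ^ (1 / q) ⌉
⌈root⌉ : (q x : ℕ) → ℕ
⌈root⌉ q x = leastRoot q x x

⌈root⌉-upper : ∀ q x .{{_ : NonZero q}} → x ℕ.≤ ⌈root⌉ q x ℕ.^ q
⌈root⌉-upper q@(suc _) zero    = z≤n
⌈root⌉-upper q@(suc r) (suc x) = leastRoot-upper q (suc x) (suc x)
  (ℕ.m≤m*n (suc x) (suc x ℕ.^ r) {{ℕ.m^n≢0 (suc x) r}})

^-cancelˡ-≤ : ∀ q .{{_ : NonZero q}} {s t} → s ℕ.^ q ℕ.≤ t ℕ.^ q → s ℕ.≤ t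
^-cancelˡ-≤ q {s} {t} h with s ℕ.≤? t
... | yes s≤t = s≤t
... | no  s≰t = ⊥-elim (ℕ.<⇒≱ (ℕ.^-monoˡ-< q (ℕ.≰⇒> s≰t)) h)

^-distribʳ-* : ∀ q a b → (a ℕ.* b) ℕ.^ q ≡ a ℕ.^ q ℕ.* b ℕ.^ q
^-distribʳ-* zero    a b = refl
^-distribʳ-* (suc q) a b = trans (cong (a ℕ.* b ℕ.*_) (^-distribʳ-* q a b))
  (swap a b (a ℕ.^ q) (b ℕ.^ q))
  where
  swap : ∀ a b c d → (a ℕ.* b) ℕ.* (c ℕ.* d) ≡ (a ℕ.* c) ℕ.* (b ℕ.* d)
  swap = solve-∀

-- y ^ (1 / q) is approximated from above, to within 1 / (m + 1), by the
-- fractions t / (m + 1).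
rootSeq : (y q : ℕ) → ℕ → ℚ
rootSeq y q m = + ⌈root⌉ q (y ℕ.* suc m ℕ.^ q) / suc m

module _ (y q : ℕ) .{{_ : NonZero q}} where

  root-cross : ∀ m n s t → ⌈root⌉ q (y ℕ.* suc m ℕ.^ q) ≡ s → ⌈root⌉ q (y ℕ.* suc n ℕ.^ q) ≡ t →
               s ℕ.* suc n ℕ.≤ t ℕ.* suc m ℕ.+ suc n
  root-cross m n zero    t _    _    = z≤n
  root-cross m n (suc s) t s-eq refl = ℕ.≤-trans
    (ℕ.+-monoʳ-≤ (suc n) (^-cancelˡ-≤ q (begin
      (s ℕ.* suc n) ℕ.^ q                       ≡⟨ ^-distribʳ-* q s (suc n) ⟩
      s ℕ.^ q ℕ.* suc n ℕ.^ q                   ≤⟨ ℕ.*-monoˡ-≤ (suc n ℕ.^ q) (ℕ.<⇒≤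
                                                     (leastRoot-least q x x s-eq)) ⟩
      (y ℕ.* suc m ℕ.^ q) ℕ.* suc n ℕ.^ q       ≡⟨ swap y (suc m ℕ.^ q) (suc n ℕ.^ q) ⟩
      (y ℕ.* suc n ℕ.^ q) ℕ.* suc m ℕ.^ q       ≤⟨ ℕ.*-monoˡ-≤ (suc m ℕ.^ q)
                                                     (⌈root⌉-upper q (y ℕ.* suc n ℕ.^ q)) ⟩
      t ℕ.^ q ℕ.* suc m ℕ.^ q                   ≡⟨ ^-distribʳ-* q t (suc m) ⟨
      (t ℕ.* suc m) ℕ.^ q                       ∎)))
    (ℕ.≤-reflexive (ℕ.+-comm (suc n) (t ℕ.* suc m)))
    where
    open ℕ.≤-Reasoning
    x = y ℕ.* suc m ℕ.^ q
    swap : ∀ a b c → (a ℕ.* b) ℕ.* c ≡ (a ℕ.* c) ℕ.* b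
    swap = solve-∀

  rootSeq-close : ∀ m n → rootSeq y q m ≤ rootSeq y q n + + 1 / suc m
  rootSeq-close m n = ℚ.≤-trans
    (/-mono-≤ s (suc m) (t ℕ.* suc m ℕ.+ 1 ℕ.* suc n) (suc n ℕ.* suc m) (begin
      s ℕ.* (suc n ℕ.* suc m)                         ≡⟨ ℕ.*-assoc s (suc n) (suc m) ⟨
      s ℕ.* suc n ℕ.* suc m                           ≤⟨ ℕ.*-monoˡ-≤ (suc m) (root-cross m n s t refl refl) ⟩
      (t ℕ.* suc m ℕ.+ suc n) ℕ.* suc m               ≡⟨ cong (λ z → (t ℕ.* suc m ℕ.+ z) ℕ.* suc m)
                                                           (ℕ.*-identityˡ (suc n)) ⟨
      (t ℕ.* suc m ℕ.+ 1 ℕ.* suc n) ℕ.* suc m         ∎))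
    (ℚ.≤-reflexive (sym (/-+ t (suc n) 1 (suc m))))
    where
    open ℕ.≤-Reasoning
    s = ⌈root⌉ q (y ℕ.* suc m ℕ.^ q)
    t = ⌈root⌉ q (y ℕ.* suc n ℕ.^ q)

  rootSeq-rate : ∀ {N m n} → N ℕ.< m → N ℕ.< n →
                 rootSeq y q m ≤ rootSeq y q n + + 1 / suc N
  rootSeq-rate {N} {m} {n} N<m _ = ℚ.≤-trans (rootSeq-close m n)
    (ℚ.+-monoʳ-≤ (rootSeq y q n) (/-mono-≤ 1 (suc m) 1 (suc N)
      (ℕ.*-monoʳ-≤ 1 (s≤s (ℕ.<⇒≤ N<m)))))

  1≤rootSeq : .{{_ : NonZero y}} → ∀ m → 1ℚ ≤ rootSeq y q m
  1≤rootSeq m = /-mono-≤ 1 1 (⌈root⌉ q (y ℕ.* suc m ℕ.^ q)) (suc m)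
    (subst₂ ℕ._≤_ (sym (ℕ.*-identityˡ (suc m))) (sym (ℕ.*-identityʳ _))
      (^-cancelˡ-≤ q (ℕ.≤-trans (ℕ.m≤n*m (suc m ℕ.^ q) y)
        (⌈root⌉-upper q (y ℕ.* suc m ℕ.^ q)))))

root : (q y : ℕ) .{{_ : NonZero q}} .{{_ : NonZero y}} → ℝ⁺
root q y = positiveReal (real (rootSeq y q) (cauchyByRate (rootSeq y q) (rootSeq-rate y q))) record
  { ε   = 1ℚ
  ; 0<ε = ℚ.positive⁻¹ 1ℚ
  ; N   = 0
  ; gap = λ {m} _ → 1≤rootSeq y q m
  }

-- The real power with rational exponent p / q, as the q-th root of a ^ p.
infixr 8 _^[_/_]

_^[_/_] : (a p q : ℕ) .{{_ : NonZero a}} .{{_ : NonZero q}} → ℝ⁺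
a ^[ p / q ] = root q (a ℕ.^ p)
  where
  instance
    a^p≢0 : NonZero (a ℕ.^ p)
    a^p≢0 = ℕ.m^n≢0 a p

{-# OPTIONS --safe #-}

-- Put D = 1 + Δ.  Deleting vertices from overfull neighbourhoods turns any vertex
-- set X into a k-limited packing, at the cost of at most one vertex for each
-- (k + 1)-subset of some N[v] ∩ X.  Averaging over a random X that contains every
-- vertex with probability p gives L ≥ n p − n C(D, k + 1) pᵏ⁺¹.  With rationals
-- c = ∑_{i ≤ k} 1 / i! < e and t ≥ D^(1 + 1/k), the choice p = (k + 1) / (c t)
-- yields L ≥ k n / (c t), because C(D, k + 1) (k + 1)! ≤ Dᵏ⁺¹ and (k + 1)ᵏ ≤ k! cᵏ.
module Submission where

open import Defs
open import Algebra.Bundles using (CommutativeRing)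
open import Data.Bool.Base using (true; false)
open import Data.Fin.Base as Fin using (Fin)
open import Data.Fin.Properties using (nonZeroIndex)
open import Data.Fin.Subset
  using (Subset; inside; outside; ∣_∣; _∩_; _∪_; ⁅_⁆; _∈_; _∉_; _⊆_; Nonempty)
  renaming (_-_ to _∖_)
open import Data.Fin.Subset.Properties
  using (nonempty?; Empty-unique; ∣⊥∣≡0; ∣⁅x⁆∣≡1; p∩q⊆p; p∩q⊆q; x∈p∩q⁺; x∈p⇒p-x⊂p;
         p⊂q⇒∣p∣<∣q∣; p⊆q⇒∣p∣≤∣q∣; p─⊥≡p)
open import Data.Integer.Base using (+_)
import Data.Integer.Properties as ℤ
open import Data.List.Base using (List; []; _∷_; map; length; tabulate)
open import Data.List.Properties using (length-tabulate)
open import Data.List.Relation.Unary.All as All using (All; []; _∷_)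
import Data.List.Relation.Unary.All.Properties as All
open import Data.List.Relation.Unary.Any using (here; there)
import Data.List.Membership.Propositional as List
open import Data.Nat.Base using (ℕ; zero; suc; z≤n; s≤s; NonZero; _+_; _*_; _≤_; _<_; _!)
import Data.Nat.Base as ℕ
open import Data.Nat.Combinatorics
  using (_P_; _C_; nCn≡1; nCk≡nPk/k!; k>n⇒nCk≡0; nCk+nC[k+1]≡[n+1]C[k+1])
open import Data.Nat.Combinatorics.Base using (_P′_)
open import Data.Nat.DivMod using (m/n*n≤m)
open import Data.Nat.ListAction using (sum)
import Data.Nat.Properties as ℕ
open import Data.Product.Base using (∃-syntax; _×_; _,_; proj₁; proj₂)
open import Data.Rational.Base as ℚ using (ℚ; 0ℚ; 1ℚ; _/_)
import Data.Rational.Properties as ℚ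
open import Data.Rational.Solver using (module +-*-Solver)
import Data.Rational.Unnormalised.Base as ℚᵘ
import Data.Rational.Unnormalised.Properties as ℚᵘ
open import Data.Vec.Base using ([]; _∷_)
import Data.Vec.Base as Vec
open import Function.Base using (_∘_; it)
open import Relation.Binary.PropositionalEquality
  using (_≡_; refl; sym; trans; cong; cong₂; subst; subst₂; module ≡-Reasoning)
open import Relation.Nullary.Decidable using (yes; no)
open import Relation.Nullary.Negation using (contradiction)

open import Algebra.Properties.CommutativeSemiring.Exp
  (CommutativeRing.commutativeSemiring ℚ.+-*-commutativeRing)
  using (_^_; ^-distrib-*)

open +-*-Solver using (solve; _:+_; _:*_; _:-_; _:=_; con)

-- Monotonicity and size of binomial coefficients.

C-suc-≤ : ∀ n k → n C k ≤ suc n C k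
C-suc-≤ n zero    = ℕ.≤-refl
C-suc-≤ n (suc k) = subst (n C suc k ≤_) (nCk+nC[k+1]≡[n+1]C[k+1] n k) (ℕ.m≤n+m _ _)

C-monoˡ-≤ : ∀ k {m n} → m ≤ n → m C k ≤ n C k
C-monoˡ-≤ k {m} m≤n = subst (λ i → m C k ≤ i C k) (ℕ.m∸n+n≡m m≤n) (go _)
  where
  go : ∀ d → m C k ≤ (d + m) C k
  go zero    = ℕ.≤-refl
  go (suc d) = ℕ.≤-trans (go d) (C-suc-≤ (d + m) k)

1≤nCk : ∀ {n k} → k ≤ n → 1 ≤ n C k
1≤nCk {n} {k} k≤n = subst (_≤ n C k) (nCn≡1 k) (C-monoˡ-≤ k k≤n)

-- By Pascal's rule the last unit step adds a coefficient that is at least 1 because `k` does not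
-- exceed its upper index. This strictness makes every deletion below pay for itself.
C-monoˡ-< : ∀ {k m n} → k < n → m < n → m C suc k < n C suc k
C-monoˡ-< {k} {m} {suc n} (s≤s k≤n) (s≤s m≤n) =
  subst (m C suc k <_) (nCk+nC[k+1]≡[n+1]C[k+1] n k)
    (ℕ.+-mono-≤ (1≤nCk k≤n) (C-monoˡ-≤ (suc k) m≤n))

nP′k≤n^k : ∀ n k → n P′ k ≤ n ℕ.^ k
nP′k≤n^k n zero    = ℕ.≤-refl
nP′k≤n^k n (suc k) = ℕ.*-mono-≤ (ℕ.m∸n≤m n k) (nP′k≤n^k n k)

nPk≤n^k : ∀ n k → n P k ≤ n ℕ.^ k
nPk≤n^k n k with k ℕ.≤ᵇ n
... | true  = nP′k≤n^k n k
-- `n P k` is 0 by definition when `k` exceeds `n`.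
... | false = z≤n

-- The product is at most the falling factorial `n P k`, whose `k` factors are each at most `n`.
nCk*k!≤n^k : ∀ n k → (n C k) * k ! ≤ n ℕ.^ k
nCk*k!≤n^k n k with k ℕ.≤? n
... | yes k≤n = ℕ.≤-trans
  (ℕ.≤-reflexive (cong (_* k !) (nCk≡nPk/k! k≤n)))
  (ℕ.≤-trans (m/n*n≤m (n P k) (k !) {{ℕ._!≢0 k}}) (nPk≤n^k n k))
... | no  k≰n = subst (λ c → c * k ! ≤ n ℕ.^ k) (sym (k>n⇒nCk≡0 (ℕ.≰⇒> k≰n))) z≤n

-- Cardinalities of finite subsets.

∣p∪q∣≤∣p∣+∣q∣ : ∀ {n} (p q : Subset n) → ∣ p ∪ q ∣ ≤ ∣ p ∣ + ∣ q ∣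
∣p∪q∣≤∣p∣+∣q∣ []            []            = z≤n
∣p∪q∣≤∣p∣+∣q∣ (outside ∷ p) (outside ∷ q) = ∣p∪q∣≤∣p∣+∣q∣ p q
∣p∪q∣≤∣p∣+∣q∣ (outside ∷ p) (inside  ∷ q) =
  subst (suc ∣ p ∪ q ∣ ≤_) (sym (ℕ.+-suc ∣ p ∣ ∣ q ∣)) (s≤s (∣p∪q∣≤∣p∣+∣q∣ p q))
∣p∪q∣≤∣p∣+∣q∣ (inside  ∷ p) (outside ∷ q) = s≤s (∣p∪q∣≤∣p∣+∣q∣ p q)
∣p∪q∣≤∣p∣+∣q∣ (inside  ∷ p) (inside  ∷ q) =
  s≤s (ℕ.≤-trans (∣p∪q∣≤∣p∣+∣q∣ p q) (ℕ.+-monoʳ-≤ ∣ p ∣ (ℕ.n≤1+n ∣ q ∣)))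

∣p∣≤1+∣p-x∣ : ∀ {n} (p : Subset n) x → ∣ p ∣ ≤ suc ∣ p ∖ x ∣
∣p∣≤1+∣p-x∣ (inside  ∷ p) Fin.zero    = s≤s (ℕ.≤-reflexive (cong ∣_∣ (sym (p─⊥≡p p))))
∣p∣≤1+∣p-x∣ (outside ∷ p) Fin.zero    =
  ℕ.m≤n⇒m≤1+n (ℕ.≤-reflexive (cong ∣_∣ (sym (p─⊥≡p p))))
∣p∣≤1+∣p-x∣ (inside  ∷ p) (Fin.suc x) = s≤s (∣p∣≤1+∣p-x∣ p x)
∣p∣≤1+∣p-x∣ (outside ∷ p) (Fin.suc x) = ∣p∣≤1+∣p-x∣ p x

x∉p-x : ∀ {n} (p : Subset n) x → x ∉ p ∖ x
x∉p-x (_ ∷ p) (Fin.suc x) (Vec.there x∈) = x∉p-x p x x∈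

∩-monoʳ-⊆ : ∀ {n} (p : Subset n) {q r} → q ⊆ r → p ∩ q ⊆ p ∩ r
∩-monoʳ-⊆ p {q} q⊆r x∈ = x∈p∩q⁺ (p∩q⊆p p q x∈ , q⊆r (p∩q⊆q p q x∈))

0<∣p∣⇒Nonempty : ∀ {n} (p : Subset n) → 0 < ∣ p ∣ → Nonempty p
0<∣p∣⇒Nonempty {n} p 0<∣p∣ with nonempty? p
... | yes ne = ne
... | no ¬ne = contradiction
  (subst (0 <_) (trans (cong ∣_∣ (Empty-unique ¬ne)) (∣⊥∣≡0 n)) 0<∣p∣) λ ()

-- Deleting vertices until a set becomes a packing.

module _ {n : ℕ} (k : ℕ) where

  -- The number of pairs (A , S) with S ⊆ A ∩ X and ∣ S ∣ = k + 1.
  overload : List (Subset n) → Subset n → ℕ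
  overload As X = sum (map (λ A → ∣ A ∩ X ∣ C suc k) As)

  Packs : List (Subset n) → Subset n → Set
  Packs As X = All (λ A → ∣ A ∩ X ∣ ≤ k) As

  overload-mono : ∀ As {X Y} → Y ⊆ X → overload As Y ≤ overload As X
  overload-mono []       Y⊆X = z≤n
  overload-mono (A ∷ As) Y⊆X = ℕ.+-mono-≤
    (C-monoˡ-≤ (suc k) (p⊆q⇒∣p∣≤∣q∣ (∩-monoʳ-⊆ A Y⊆X))) (overload-mono As Y⊆X)

  -- The term of `A` drops strictly, since an overfull `A ∩ X` has a (`k` + 1)-subset through `x`;
  -- no other term grows.
  overload-remove : ∀ {As A X x} → A List.∈ As → k < ∣ A ∩ X ∣ → x ∈ A ∩ X →
                    overload As (X ∖ x) < overload As X
  overload-remove {A ∷ As} {X = X} {x} (here refl) k< x∈ = ℕ.+-mono-<-≤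
    (C-monoˡ-< k< (p⊂q⇒∣p∣<∣q∣ (∩-monoʳ-⊆ A (proj₁ X-x⊂X) , x , x∈ , x∉)))
    (overload-mono As (proj₁ X-x⊂X))
    where
    X-x⊂X = x∈p⇒p-x⊂p (p∩q⊆q A X x∈)
    x∉ : x ∉ A ∩ (X ∖ x)
    x∉ = x∉p-x X x ∘ p∩q⊆q A (X ∖ x)
  overload-remove {A ∷ As} {X = X} (there A∈) k< x∈ = ℕ.+-mono-≤-<
    (C-monoˡ-≤ (suc k) (p⊆q⇒∣p∣≤∣q∣ (∩-monoʳ-⊆ A (proj₁ (x∈p⇒p-x⊂p (p∩q⊆q _ X x∈))))))
    (overload-remove A∈ k< x∈)

  -- Greedy deletion: as long as some `A ∩ X` is overfull, drop one of its elements. Each deletion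
  -- costs one element and lowers the overload by at least one, so the overload pays for all of
  -- them.
  prune : ∀ As X → ∃[ Y ] Packs As Y × ∣ X ∣ ≤ ∣ Y ∣ + overload As X
  prune As X = go _ X ℕ.≤-refl
    where
    go : ∀ b X → overload As X ≤ b → ∃[ Y ] Packs As Y × ∣ X ∣ ≤ ∣ Y ∣ + overload As X
    go b X o≤b with All.all? (λ A → ∣ A ∩ X ∣ ℕ.≤? k) As
    ... | yes packs = X , packs , ℕ.m≤m+n ∣ X ∣ _
    ... | no ¬packs with List.find (All.¬All⇒Any¬ (λ A → ∣ A ∩ X ∣ ℕ.≤? k) As ¬packs)
    ... | A , A∈ , ≰k with 0<∣p∣⇒Nonempty (A ∩ X) (ℕ.≤-<-trans z≤n (ℕ.≰⇒> ≰k))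
    ... | x , x∈ with b | ℕ.<-≤-trans (overload-remove A∈ (ℕ.≰⇒> ≰k) x∈) o≤b
    -- The strict drop of the overload rules out `b = 0`, so the bound `b` decreases and the
    -- recursion terminates.
    ... | suc b | s≤s o′≤b with go b (X ∖ x) o′≤b
    ... | Y , packs , X-x≤ = Y , packs , (begin
      ∣ X ∣                                  ≤⟨ ∣p∣≤1+∣p-x∣ X x ⟩
      suc ∣ X ∖ x ∣                          ≤⟨ s≤s X-x≤ ⟩
      suc (∣ Y ∣ + overload As (X ∖ x))      ≡⟨ ℕ.+-suc ∣ Y ∣ _ ⟨
      ∣ Y ∣ + suc (overload As (X ∖ x))      ≤⟨ ℕ.+-monoʳ-≤ ∣ Y ∣ (overload-remove A∈ (ℕ.≰⇒> ≰k) x∈) ⟩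
      ∣ Y ∣ + overload As X                  ∎)
      where open ℕ.≤-Reasoning

closedNbhds : ∀ {n} → SimpleGraph n → List (Subset n)
closedNbhds G = tabulate (N[_] G)

∣N[v]∣≤1+degree : ∀ {n} (G : SimpleGraph n) v → ∣ N[_] G v ∣ ≤ 1 + degree G v
∣N[v]∣≤1+degree G v = subst (λ i → ∣ N[_] G v ∣ ≤ i + degree G v) (∣⁅x⁆∣≡1 v)
  (∣p∪q∣≤∣p∣+∣q∣ ⁅ v ⁆ (SimpleGraph.neighbours G v))

-- The pruned set is a `k`-limited packing, so the maximality of `L k G` bounds its size.
∣X∣≤L+overload : ∀ {n} k (G : SimpleGraph n) X → ∣ X ∣ ≤ L k G + overload k (closedNbhds G) X
∣X∣≤L+overload k G X with prune k (closedNbhds G) X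
... | Y , packs , X≤ = ℕ.≤-trans X≤ (ℕ.+-monoˡ-≤ (overload k (closedNbhds G) X)
  (proj₂ (proj₂ (limitedPackingNumber k G)) (Y , All.tabulate⁻ packs , refl)))

-- Naturals inside the rationals, order and powers.

/-* : ∀ a b c d .{{_ : NonZero b}} .{{_ : NonZero d}} .{{_ : NonZero (b * d)}} →
      (+ a / b) ℚ.* (+ c / d) ≡ + (a * c) / (b * d)
/-* a b@(suc _) c d@(suc _) = ℚ.toℚᵘ-injective
  (ℚᵘ.≃-trans (ℚ.toℚᵘ-homo-* (+ a / b) (+ c / d))
  (ℚᵘ.≃-trans (ℚᵘ.*-cong (/-toℚᵘ a b) (/-toℚᵘ c d))
  (ℚᵘ.≃-trans (ℚᵘ.≃-reflexive (cong (ℚᵘ._/ (b * d)) (sym (ℤ.pos-* a c))))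
  (ℚᵘ.≃-sym (/-toℚᵘ _ (b * d))))))

-- Opaque because unification would otherwise unfold the gcd computation in _/_.
opaque
  ι : ℕ → ℚ
  ι n = + n / 1

  ι-def : ∀ n → ι n ≡ + n / 1
  ι-def n = refl

  ι-0 : ι 0 ≡ 0ℚ
  ι-0 = refl

  ι-1 : ι 1 ≡ 1ℚ
  ι-1 = refl

  ι-homo-+ : ∀ a b → ι (a + b) ≡ ι a ℚ.+ ι b
  ι-homo-+ a b = sym (trans (/-+ a 1 b 1)
    (cong ι (cong₂ _+_ (ℕ.*-identityʳ a) (ℕ.*-identityʳ b))))

  ι-homo-* : ∀ a b → ι (a * b) ≡ ι a ℚ.* ι b
  ι-homo-* a b = sym (/-* a 1 b 1)

  ι-mono-≤ : ∀ {a b} → a ≤ b → ι a ℚ.≤ ι b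
  ι-mono-≤ {a} {b} a≤b = /-mono-≤ a 1 b 1 (ℕ.*-monoˡ-≤ 1 a≤b)

  ι-≤-/ : ∀ a b c .{{_ : NonZero c}} → a * c ≤ b → ι a ℚ.≤ + b / c
  ι-≤-/ a b c h = /-mono-≤ a 1 b c (subst (a * c ≤_) (sym (ℕ.*-identityʳ b)) h)

  a/b*b≡a : ∀ a b .{{_ : NonZero b}} → (+ a / b) ℚ.* ι b ≡ ι a
  -- Equal cross products give both inequalities, which avoids comparing normalised fractions.
  a/b*b≡a a b@(suc _) = trans (/-* a b b 1) (ℚ.≤-antisym
    (/-mono-≤ (a * b) (b * 1) a 1 (ℕ.≤-reflexive eq))
    (/-mono-≤ a 1 (a * b) (b * 1) (ℕ.≤-reflexive (sym eq))))
    where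
    eq : a * b * 1 ≡ a * (b * 1)
    eq = ℕ.*-assoc a b 1

ι-suc : ∀ n → ι (suc n) ≡ 1ℚ ℚ.+ ι n
ι-suc n = trans (ι-homo-+ 1 n) (cong (ℚ._+ ι n) ι-1)

ι-homo-^ : ∀ a k → ι (a ℕ.^ k) ≡ ι a ^ k
ι-homo-^ a zero    = ι-1
ι-homo-^ a (suc k) = trans (ι-homo-* a (a ℕ.^ k)) (cong (ι a ℚ.*_) (ι-homo-^ a k))

0≤ι : ∀ n → 0ℚ ℚ.≤ ι n
0≤ι n = subst (ℚ._≤ ι n) ι-0 (ι-mono-≤ z≤n)

0<ι : ∀ n .{{_ : NonZero n}} → 0ℚ ℚ.< ι n
0<ι (suc n) = ℚ.<-≤-trans (ℚ.positive⁻¹ 1ℚ) (subst (ℚ._≤ ι (suc n)) ι-1 (ι-mono-≤ (s≤s z≤n)))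

*-nonNeg : ∀ {p q} → 0ℚ ℚ.≤ p → 0ℚ ℚ.≤ q → 0ℚ ℚ.≤ p ℚ.* q
*-nonNeg {p} {q} 0≤p 0≤q = subst (ℚ._≤ p ℚ.* q) (ℚ.*-zeroʳ 0ℚ)
  (*-mono-≤-nonNeg {0ℚ} {p} {0ℚ} {q} ℚ.≤-refl 0≤p 0≤p 0≤q)

*-monoˡ-≤ : ∀ r {p q} → 0ℚ ℚ.≤ r → p ℚ.≤ q → r ℚ.* p ℚ.≤ r ℚ.* q
*-monoˡ-≤ r 0≤r = ℚ.*-monoˡ-≤-nonNeg r {{ℚ.nonNegative 0≤r}}

*-monoʳ-≤ : ∀ r {p q} → 0ℚ ℚ.≤ r → p ℚ.≤ q → p ℚ.* r ℚ.≤ q ℚ.* r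
*-monoʳ-≤ r 0≤r = ℚ.*-monoʳ-≤-nonNeg r {{ℚ.nonNegative 0≤r}}

*-cancelˡ-≤ : ∀ r {p q} → 0ℚ ℚ.< r → r ℚ.* p ℚ.≤ r ℚ.* q → p ℚ.≤ q
*-cancelˡ-≤ r 0<r = ℚ.*-cancelˡ-≤-pos r {{ℚ.positive 0<r}}

+-cancelˡ-≤ : ∀ r {p q} → r ℚ.+ p ℚ.≤ r ℚ.+ q → p ℚ.≤ q
+-cancelˡ-≤ r {p} {q} h =
  subst₂ ℚ._≤_ (+-cancel r p) (+-cancel r q) (ℚ.+-monoˡ-≤ (ℚ.- r) h)

^-nonNeg : ∀ {p} k → 0ℚ ℚ.≤ p → 0ℚ ℚ.≤ p ^ k
^-nonNeg zero    0≤p = ℚ.nonNegative⁻¹ 1ℚ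
^-nonNeg {p} (suc k) 0≤p = *-nonNeg {p} {p ^ k} 0≤p (^-nonNeg k 0≤p)

^-pos : ∀ {p} k → 0ℚ ℚ.< p → 0ℚ ℚ.< p ^ k
^-pos zero    0<p = ℚ.positive⁻¹ 1ℚ
^-pos {p} (suc k) 0<p = *-pos {p} {p ^ k} 0<p (^-pos k 0<p)

^-monoˡ-≤ : ∀ {p q} k → 0ℚ ℚ.≤ p → p ℚ.≤ q → p ^ k ℚ.≤ q ^ k
^-monoˡ-≤ zero    0≤p p≤q = ℚ.≤-refl
^-monoˡ-≤ {p} {q} (suc k) 0≤p p≤q =
  *-mono-≤-nonNeg {p} {q} {p ^ k} {q ^ k} (^-nonNeg k 0≤p) (ℚ.≤-trans 0≤p p≤q)
  p≤q (^-monoˡ-≤ k 0≤p p≤q)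

1^k≡1 : ∀ k → 1ℚ ^ k ≡ 1ℚ
1^k≡1 zero    = refl
1^k≡1 (suc k) = trans (ℚ.*-identityˡ (1ℚ ^ k)) (1^k≡1 k)

ι-pascal : ∀ n k → ι (suc n C suc k) ≡ ι (n C k) ℚ.+ ι (n C suc k)
ι-pascal n k = trans (cong ι (sym (nCk+nC[k+1]≡[n+1]C[k+1] n k))) (ι-homo-+ (n C k) _)

-- Expectations over a random vertex set.

module _ (p : ℚ) where

  mix : ℚ → ℚ → ℚ
  mix a b = p ℚ.* a ℚ.+ (1ℚ ℚ.- p) ℚ.* b

  -- The expectation of f at a random subset that contains each element
  -- independently with probability p.
  𝔼 : ∀ {n} → (Subset n → ℚ) → ℚ
  𝔼 {zero}  f = f []
  𝔼 {suc n} f = mix (𝔼 (f ∘ (inside ∷_))) (𝔼 (f ∘ (outside ∷_)))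

  𝔼-cong : ∀ {n} {f g : Subset n → ℚ} → (∀ X → f X ≡ g X) → 𝔼 f ≡ 𝔼 g
  𝔼-cong {zero}  f≡g = f≡g []
  𝔼-cong {suc n} f≡g = cong₂ mix (𝔼-cong (f≡g ∘ (inside ∷_))) (𝔼-cong (f≡g ∘ (outside ∷_)))

  mix-const : ∀ c → mix c c ≡ c
  mix-const = solve 2 (λ p c → p :* c :+ (con 1ℚ :- p) :* c := c) refl p

  mix-+ : ∀ a b c d → mix (a ℚ.+ b) (c ℚ.+ d) ≡ mix a c ℚ.+ mix b d
  mix-+ = solve 5 (λ p a b c d →
    p :* (a :+ b) :+ (con 1ℚ :- p) :* (c :+ d) :=
    p :* a :+ (con 1ℚ :- p) :* c :+ (p :* b :+ (con 1ℚ :- p) :* d)) refl p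

  -- The shape of each induction over the first element: its presence, of probability `p`, raises
  -- the value from `b` to `a + b`.
  mix-shift : ∀ a b → mix (a ℚ.+ b) b ≡ a ℚ.* p ℚ.+ b
  mix-shift = solve 3 (λ p a b → p :* (a :+ b) :+ (con 1ℚ :- p) :* b := a :* p :+ b) refl p

  𝔼-const : ∀ n c → 𝔼 {n} (λ _ → c) ≡ c
  𝔼-const zero    c = refl
  𝔼-const (suc n) c = trans (cong₂ mix (𝔼-const n c) (𝔼-const n c)) (mix-const c)

  𝔼-+ : ∀ {n} (f g : Subset n → ℚ) → 𝔼 (λ X → f X ℚ.+ g X) ≡ 𝔼 f ℚ.+ 𝔼 g
  𝔼-+ {zero}  f g = refl
  𝔼-+ {suc n} f g = trans
    (cong₂ mix (𝔼-+ (f ∘ (inside ∷_)) (g ∘ (inside ∷_)))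
               (𝔼-+ (f ∘ (outside ∷_)) (g ∘ (outside ∷_))))
    (mix-+ (𝔼 (f ∘ (inside ∷_))) (𝔼 (g ∘ (inside ∷_)))
           (𝔼 (f ∘ (outside ∷_))) (𝔼 (g ∘ (outside ∷_))))

  𝔼∣X∣ : ∀ n → 𝔼 {n} (ι ∘ ∣_∣) ≡ ι n ℚ.* p
  𝔼∣X∣ zero    = trans ι-0 (sym (trans (cong (ℚ._* p) ι-0) (ℚ.*-zeroˡ p)))
  𝔼∣X∣ (suc n) = begin
    mix (𝔼 {n} (λ X → ι (suc ∣ X ∣))) (𝔼 {n} (ι ∘ ∣_∣))
      ≡⟨ cong (λ a → mix a (𝔼 {n} (ι ∘ ∣_∣))) (trans (𝔼-cong {n} (λ X → ι-suc ∣ X ∣))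
           (trans (𝔼-+ {n} (λ _ → 1ℚ) (ι ∘ ∣_∣)) (cong (ℚ._+ 𝔼 {n} (ι ∘ ∣_∣)) (𝔼-const n 1ℚ)))) ⟩
    mix (1ℚ ℚ.+ 𝔼 {n} (ι ∘ ∣_∣)) (𝔼 {n} (ι ∘ ∣_∣))
      ≡⟨ mix-shift 1ℚ (𝔼 {n} (ι ∘ ∣_∣)) ⟩
    1ℚ ℚ.* p ℚ.+ 𝔼 {n} (ι ∘ ∣_∣)
      ≡⟨ cong (1ℚ ℚ.* p ℚ.+_) (𝔼∣X∣ n) ⟩
    1ℚ ℚ.* p ℚ.+ ι n ℚ.* p
      ≡⟨ ℚ.*-distribʳ-+ p 1ℚ (ι n) ⟨
    (1ℚ ℚ.+ ι n) ℚ.* p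
      ≡⟨ cong (ℚ._* p) (ι-suc n) ⟨
    ι (suc n) ℚ.* p ∎
    where open ≡-Reasoning

  -- Each `k`-subset of `A` lies in `X` with probability `p ^ k`. The induction splits the subsets
  -- by Pascal's rule according to whether they contain the first element.
  𝔼-C : ∀ {n} (A : Subset n) k → 𝔼 (λ X → ι (∣ A ∩ X ∣ C k)) ≡ ι (∣ A ∣ C k) ℚ.* p ^ k
  𝔼-C {n} A zero = trans (𝔼-const n (ι 1)) (sym (ℚ.*-identityʳ (ι 1)))
  𝔼-C []  (suc k) = trans ι-0 (sym (trans (cong (ℚ._* p ^ suc k) ι-0) (ℚ.*-zeroˡ (p ^ suc k))))
  𝔼-C (outside ∷ A) (suc k) =
    trans (mix-const (𝔼 (λ X → ι (∣ A ∩ X ∣ C suc k)))) (𝔼-C A (suc k))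
  𝔼-C {suc n} (inside ∷ A) (suc k) = begin
    mix (𝔼 (λ X → ι (suc ∣ A ∩ X ∣ C suc k))) (𝔼 f′)
      ≡⟨ cong (λ a → mix a (𝔼 f′)) (trans (𝔼-cong (λ X → ι-pascal ∣ A ∩ X ∣ k)) (𝔼-+ f f′)) ⟩
    mix (𝔼 f ℚ.+ 𝔼 f′) (𝔼 f′)
      ≡⟨ mix-shift (𝔼 f) (𝔼 f′) ⟩
    𝔼 f ℚ.* p ℚ.+ 𝔼 f′
      ≡⟨ cong₂ (λ a b → a ℚ.* p ℚ.+ b) (𝔼-C A k) (𝔼-C A (suc k)) ⟩
    ι (∣ A ∣ C k) ℚ.* p ^ k ℚ.* p ℚ.+ ι (∣ A ∣ C suc k) ℚ.* p ^ suc k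
      ≡⟨ solve 4 (λ p pᵏ a b →
           a :* pᵏ :* p :+ b :* (p :* pᵏ) := (a :+ b) :* (p :* pᵏ)) refl
           p (p ^ k) (ι (∣ A ∣ C k)) (ι (∣ A ∣ C suc k)) ⟩
    (ι (∣ A ∣ C k) ℚ.+ ι (∣ A ∣ C suc k)) ℚ.* p ^ suc k
      ≡⟨ cong (ℚ._* p ^ suc k) (ι-pascal ∣ A ∣ k) ⟨
    ι (suc ∣ A ∣ C suc k) ℚ.* p ^ suc k ∎
    where
    open ≡-Reasoning
    f f′ : Subset n → ℚ
    f  X = ι (∣ A ∩ X ∣ C k)
    f′ X = ι (∣ A ∩ X ∣ C suc k)

  module _ (0≤p : 0ℚ ℚ.≤ p) (p≤1 : p ℚ.≤ 1ℚ) where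

    -- Here both weights `p` and `1 - p` have to be nonnegative; the identities above hold for every
    -- rational `p`.
    𝔼-mono : ∀ {n} {f g : Subset n → ℚ} → (∀ X → f X ℚ.≤ g X) → 𝔼 f ℚ.≤ 𝔼 g
    𝔼-mono {zero}  f≤g = f≤g []
    𝔼-mono {suc n} f≤g = ℚ.+-mono-≤
      (*-monoˡ-≤ p 0≤p (𝔼-mono (f≤g ∘ (inside ∷_))))
      (*-monoˡ-≤ (1ℚ ℚ.- p) 0≤1-p (𝔼-mono (f≤g ∘ (outside ∷_))))
      where
      0≤1-p : 0ℚ ℚ.≤ 1ℚ ℚ.- p
      0≤1-p = subst (ℚ._≤ 1ℚ ℚ.- p) (ℚ.+-inverseʳ p) (ℚ.+-monoˡ-≤ (ℚ.- p) p≤1)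

    𝔼-overload : ∀ {n D} k (As : List (Subset n)) → All (λ A → ∣ A ∣ ≤ D) As →
      𝔼 (ι ∘ overload k As) ℚ.≤ ι (length As) ℚ.* (ι (D C suc k) ℚ.* p ^ suc k)
    𝔼-overload {n} {D} k [] [] =
      ℚ.≤-reflexive (trans (𝔼-const n (ι 0))
        (trans ι-0 (sym (trans (cong (ℚ._* c) ι-0) (ℚ.*-zeroˡ c)))))
      where c = ι (D C suc k) ℚ.* p ^ suc k
    𝔼-overload {n} {D} k (A ∷ As) (∣A∣≤D ∷ rest) = begin
      𝔼 (ι ∘ overload k (A ∷ As))
        ≡⟨ 𝔼-cong (λ X → ι-homo-+ (∣ A ∩ X ∣ C suc k) (overload k As X)) ⟩
      𝔼 (λ X → ι (∣ A ∩ X ∣ C suc k) ℚ.+ ι (overload k As X))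
        ≡⟨ 𝔼-+ (λ X → ι (∣ A ∩ X ∣ C suc k)) (ι ∘ overload k As) ⟩
      𝔼 (λ X → ι (∣ A ∩ X ∣ C suc k)) ℚ.+ 𝔼 (ι ∘ overload k As)
        ≡⟨ cong (ℚ._+ 𝔼 (ι ∘ overload k As)) (𝔼-C A (suc k)) ⟩
      ι (∣ A ∣ C suc k) ℚ.* p ^ suc k ℚ.+ 𝔼 (ι ∘ overload k As)
        ≤⟨ ℚ.+-mono-≤
             (*-monoʳ-≤ (p ^ suc k) (^-nonNeg (suc k) 0≤p) (ι-mono-≤ (C-monoˡ-≤ (suc k) ∣A∣≤D)))
             (𝔼-overload k As rest) ⟩
      c ℚ.+ ι (length As) ℚ.* c
        ≡⟨ solve 2 (λ c l → c :+ l :* c := (con 1ℚ :+ l) :* c) refl c (ι (length As)) ⟩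
      (1ℚ ℚ.+ ι (length As)) ℚ.* c
        ≡⟨ cong (ℚ._* c) (ι-suc (length As)) ⟨
      ι (length (A ∷ As)) ℚ.* c ∎
      where
      open ℚ.≤-Reasoning
      c = ι (D C suc k) ℚ.* p ^ suc k

    -- The expectation of `∣X∣≤L+overload`, with one overload term for each of the `n` closed
    -- neighbourhoods.
    np≤L+nCp^[k+1] : ∀ {n D} k (G : SimpleGraph n) → (∀ v → ∣ N[_] G v ∣ ≤ D) →
      ι n ℚ.* p ℚ.≤ ι (L k G) ℚ.+ ι n ℚ.* (ι (D C suc k) ℚ.* p ^ suc k)
    np≤L+nCp^[k+1] {n} {D} k G ∣N∣≤D = begin
      ι n ℚ.* p
        ≡⟨ 𝔼∣X∣ n ⟨
      𝔼 {n} (ι ∘ ∣_∣)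
        ≤⟨ 𝔼-mono (λ X → ι-mono-≤ (∣X∣≤L+overload k G X)) ⟩
      𝔼 (λ X → ι (L k G + overload k As X))
        ≡⟨ 𝔼-cong (λ X → ι-homo-+ (L k G) (overload k As X)) ⟩
      𝔼 (λ X → ι (L k G) ℚ.+ ι (overload k As X))
        ≡⟨ 𝔼-+ (λ _ → ι (L k G)) (ι ∘ overload k As) ⟩
      𝔼 {n} (λ _ → ι (L k G)) ℚ.+ 𝔼 (ι ∘ overload k As)
        ≡⟨ cong (ℚ._+ 𝔼 (ι ∘ overload k As)) (𝔼-const n (ι (L k G))) ⟩
      ι (L k G) ℚ.+ 𝔼 (ι ∘ overload k As)
        ≤⟨ ℚ.+-monoʳ-≤ (ι (L k G)) (𝔼-overload k As (All.tabulate⁺ ∣N∣≤D)) ⟩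
      ι (L k G) ℚ.+ ι (length As) ℚ.* (ι (D C suc k) ℚ.* p ^ suc k)
        ≡⟨ cong (λ l → ι (L k G) ℚ.+ ι l ℚ.* (ι (D C suc k) ℚ.* p ^ suc k)) (length-tabulate (N[_] G)) ⟩
      ι (L k G) ℚ.+ ι n ℚ.* (ι (D C suc k) ℚ.* p ^ suc k) ∎
      where
      open ℚ.≤-Reasoning
      As = closedNbhds G

-- Comparison of (1 + 1/j)ʲ with the exponential series.

-- The binomial expansion of (1 + x)ʲ cut off after degree `m`, with the same recursion on `m` as
-- `eSum`.
binomialSum : ℚ → ℕ → ℕ → ℚ
binomialSum x j zero    = 1ℚ
binomialSum x j (suc m) = binomialSum x j m ℚ.+ ι (j C suc m) ℚ.* x ^ suc m

binomialSum-pascal : ∀ x j m →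
  binomialSum x (suc j) (suc m) ≡ binomialSum x j (suc m) ℚ.+ x ℚ.* binomialSum x j m
binomialSum-pascal x j zero = begin
  1ℚ ℚ.+ ι (suc j C 1) ℚ.* x ^ 1
    ≡⟨ cong (λ c → 1ℚ ℚ.+ c ℚ.* x ^ 1) (trans (ι-pascal j 0) (cong (ℚ._+ ι (j C 1)) ι-1)) ⟩
  1ℚ ℚ.+ (1ℚ ℚ.+ ι (j C 1)) ℚ.* x ^ 1
    ≡⟨ solve 2 (λ x c → con 1ℚ :+ (con 1ℚ :+ c) :* (x :* con 1ℚ) :=
         con 1ℚ :+ c :* (x :* con 1ℚ) :+ x :* con 1ℚ) refl x (ι (j C 1)) ⟩
  1ℚ ℚ.+ ι (j C 1) ℚ.* x ^ 1 ℚ.+ x ℚ.* 1ℚ ∎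
  where open ≡-Reasoning
binomialSum-pascal x j (suc m) = begin
  binomialSum x (suc j) (suc m) ℚ.+ ι (suc j C suc (suc m)) ℚ.* x ^ suc (suc m)
    ≡⟨ cong₂ (λ b c → b ℚ.+ c ℚ.* x ^ suc (suc m)) (binomialSum-pascal x j m) (ι-pascal j (suc m)) ⟩
  (b ℚ.+ c ℚ.* x ^ suc m ℚ.+ x ℚ.* b) ℚ.+ (c ℚ.+ c′) ℚ.* x ^ suc (suc m)
    ≡⟨ solve 5 (λ x y b c c′ →
         (b :+ c :* y :+ x :* b) :+ (c :+ c′) :* (x :* y) :=
         (b :+ c :* y :+ c′ :* (x :* y)) :+ x :* (b :+ c :* y)) refl x (x ^ suc m) b c c′ ⟩
  (b ℚ.+ c ℚ.* x ^ suc m ℚ.+ c′ ℚ.* x ^ suc (suc m)) ℚ.+ x ℚ.* (b ℚ.+ c ℚ.* x ^ suc m) ∎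
  where
  open ≡-Reasoning
  b = binomialSum x j m
  c = ι (j C suc m)
  c′ = ι (j C suc (suc m))

binomialSum-0 : ∀ x m → binomialSum x 0 m ≡ 1ℚ
binomialSum-0 x zero    = refl
binomialSum-0 x (suc m) = trans
  (cong₂ (λ b c → b ℚ.+ c ℚ.* x ^ suc m) (binomialSum-0 x m) ι-0)
  (trans (cong (1ℚ ℚ.+_) (ℚ.*-zeroˡ (x ^ suc m))) (ℚ.+-identityʳ 1ℚ))

-- The cut-off may exceed `j` because the Pascal step needs exponent `j` at both cut-offs `m` and
-- `suc m`.
[1+x]^j≡binomialSum : ∀ x {j m} → j ≤ m → (1ℚ ℚ.+ x) ^ j ≡ binomialSum x j m
[1+x]^j≡binomialSum x {zero}  {m} _ = sym (binomialSum-0 x m)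
[1+x]^j≡binomialSum x {suc j} {suc m} (s≤s j≤m) = begin
  (1ℚ ℚ.+ x) ℚ.* (1ℚ ℚ.+ x) ^ j
    ≡⟨ ℚ.*-distribʳ-+ ((1ℚ ℚ.+ x) ^ j) 1ℚ x ⟩
  1ℚ ℚ.* (1ℚ ℚ.+ x) ^ j ℚ.+ x ℚ.* (1ℚ ℚ.+ x) ^ j
    ≡⟨ cong₂ ℚ._+_
         (trans (ℚ.*-identityˡ _) ([1+x]^j≡binomialSum x (ℕ.m≤n⇒m≤1+n j≤m)))
         (cong (x ℚ.*_) ([1+x]^j≡binomialSum x j≤m)) ⟩
  binomialSum x j (suc m) ℚ.+ x ℚ.* binomialSum x j m
    ≡⟨ binomialSum-pascal x j m ⟨
  binomialSum x (suc j) (suc m) ∎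
  where open ≡-Reasoning

invFact*i!≡1 : ∀ i → invFact i ℚ.* ι (i !) ≡ 1ℚ
invFact*i!≡1 i = trans (a/b*b≡a 1 (i !) {{ℕ._!≢0 i}}) ι-1

0<invFact : ∀ i → 0ℚ ℚ.< invFact i
0<invFact i = ℚ.*-cancelˡ-<-nonNeg (ι (i !)) {{ℚ.nonNegative (0≤ι (i !))}}
  (subst₂ ℚ._<_ (sym (ℚ.*-zeroʳ (ι (i !))))
    (sym (trans (ℚ.*-comm (ι (i !)) (invFact i)) (invFact*i!≡1 i))) (ℚ.positive⁻¹ 1ℚ))

module _ {x : ℚ} {j : ℕ} (0≤x : 0ℚ ℚ.≤ x) (jx≡1 : ι j ℚ.* x ≡ 1ℚ) where

  -- With x = 1/j this is C(j, i) i! ≤ jⁱ, divided by i! jⁱ.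
  C*x^i≤invFact : ∀ i → ι (j C i) ℚ.* x ^ i ℚ.≤ invFact i
  C*x^i≤invFact i = *-cancelˡ-≤ (ι (i !)) (0<ι (i !) {{ℕ._!≢0 i}}) (begin
    ι (i !) ℚ.* (ι (j C i) ℚ.* x ^ i)
      ≡⟨ solve 3 (λ f c y → f :* (c :* y) := (c :* f) :* y) refl (ι (i !)) (ι (j C i)) (x ^ i) ⟩
    (ι (j C i) ℚ.* ι (i !)) ℚ.* x ^ i
      ≡⟨ cong (ℚ._* x ^ i) (ι-homo-* (j C i) (i !)) ⟨
    ι ((j C i) * i !) ℚ.* x ^ i
      ≤⟨ *-monoʳ-≤ (x ^ i) (^-nonNeg i 0≤x) (ι-mono-≤ (nCk*k!≤n^k j i)) ⟩
    ι (j ℕ.^ i) ℚ.* x ^ i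
      ≡⟨ cong (ℚ._* x ^ i) (ι-homo-^ j i) ⟩
    ι j ^ i ℚ.* x ^ i
      ≡⟨ ^-distrib-* (ι j) x i ⟨
    (ι j ℚ.* x) ^ i
      ≡⟨ cong (_^ i) jx≡1 ⟩
    1ℚ ^ i
      ≡⟨ 1^k≡1 i ⟩
    1ℚ
      ≡⟨ trans (ℚ.*-comm (ι (i !)) (invFact i)) (invFact*i!≡1 i) ⟨
    ι (i !) ℚ.* invFact i ∎)
    where open ℚ.≤-Reasoning

  binomialSum≤eSum : ∀ m → binomialSum x j m ℚ.≤ eSum m
  binomialSum≤eSum zero    = ℚ.≤-refl
  binomialSum≤eSum (suc m) = ℚ.+-mono-≤ (binomialSum≤eSum m) (C*x^i≤invFact (suc m))

  [1+1/j]^j≤eSum : (1ℚ ℚ.+ x) ^ j ℚ.≤ eSum j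
  [1+1/j]^j≤eSum = subst (ℚ._≤ eSum j) (sym ([1+x]^j≡binomialSum x {j} ℕ.≤-refl)) (binomialSum≤eSum j)

eSum-<-suc : ∀ m → eSum m ℚ.< eSum (suc m)
eSum-<-suc m = subst (ℚ._< eSum (suc m)) (ℚ.+-identityʳ (eSum m))
  (ℚ.+-monoʳ-< (eSum m) (0<invFact (suc m)))

0<eSum : ∀ m → 0ℚ ℚ.< eSum m
0<eSum zero    = 0<invFact 0
0<eSum (suc m) = ℚ.<-trans (0<eSum m) (eSum-<-suc m)

eSum-mono-≤ : ∀ {m n} → m ≤ n → eSum m ℚ.≤ eSum n
eSum-mono-≤ {m} {n} m≤n = subst (λ i → eSum m ℚ.≤ eSum i) (ℕ.m∸n+n≡m m≤n) (eSum-mono m (n ℕ.∸ m))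

-- (k + 1)ᵏ / k! = ∏_{j ≤ k} (1 + 1/j)ʲ, and every factor is at most eSum k.
[1+k]^k≤k!*eSum^k : ∀ k → ι (suc k) ^ k ℚ.≤ ι (k !) ℚ.* eSum k ^ k
[1+k]^k≤k!*eSum^k zero    = ℚ.≤-reflexive (sym (trans (ℚ.*-identityʳ (ι 1)) ι-1))
[1+k]^k≤k!*eSum^k (suc k) = begin
  ι (suc (suc k)) ^ suc k
    ≡⟨ cong (_^ suc k) 2+k≡[1+k][1+x] ⟩
  (ι (suc k) ℚ.* (1ℚ ℚ.+ x)) ^ suc k
    ≡⟨ ^-distrib-* (ι (suc k)) (1ℚ ℚ.+ x) (suc k) ⟩
  ι (suc k) ^ suc k ℚ.* (1ℚ ℚ.+ x) ^ suc k
    ≤⟨ *-monoˡ-≤ (ι (suc k) ^ suc k) (^-nonNeg (suc k) (0≤ι (suc k)))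
         ([1+1/j]^j≤eSum {x} {suc k} 0≤x [1+k]x≡1) ⟩
  ι (suc k) ℚ.* ι (suc k) ^ k ℚ.* c
    ≤⟨ *-monoʳ-≤ c 0≤c (*-monoˡ-≤ (ι (suc k)) (0≤ι (suc k)) (ℚ.≤-trans
         ([1+k]^k≤k!*eSum^k k)
         (*-monoˡ-≤ (ι (k !)) (0≤ι (k !))
           (^-monoˡ-≤ k (ℚ.<⇒≤ (0<eSum k)) (eSum-mono k 1))))) ⟩
  ι (suc k) ℚ.* (ι (k !) ℚ.* c ^ k) ℚ.* c
    ≡⟨ solve 4 (λ a f y c → a :* (f :* y) :* c := (a :* f) :* (c :* y)) refl
         (ι (suc k)) (ι (k !)) (c ^ k) c ⟩
  (ι (suc k) ℚ.* ι (k !)) ℚ.* c ^ suc k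
    ≡⟨ cong (ℚ._* c ^ suc k) (ι-homo-* (suc k) (k !)) ⟨
  ι (suc k !) ℚ.* c ^ suc k ∎
  where
  open ℚ.≤-Reasoning
  c = eSum (suc k)
  0≤c = ℚ.<⇒≤ (0<eSum (suc k))
  x = recip (ι (suc k))
  0≤x : 0ℚ ℚ.≤ x
  0≤x = ℚ.<⇒≤ (0<recip (0<ι (suc k)))
  [1+k]x≡1 : ι (suc k) ℚ.* x ≡ 1ℚ
  [1+k]x≡1 = recip-inverseʳ (0<ι (suc k))
  2+k≡[1+k][1+x] : ι (suc (suc k)) ≡ ι (suc k) ℚ.* (1ℚ ℚ.+ x)
  2+k≡[1+k][1+x] = trans (ι-suc (suc k)) (trans (ℚ.+-comm 1ℚ (ι (suc k)))
    (sym (trans (ℚ.*-distribˡ-+ (ι (suc k)) 1ℚ x)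
      (cong₂ ℚ._+_ (ℚ.*-identityʳ (ι (suc k))) [1+k]x≡1))))

-- The first two terms of the series already sum to 2.
ι2≤eSum : ∀ k .{{_ : NonZero k}} → ι 2 ℚ.≤ eSum k
ι2≤eSum (suc k) = subst (λ i → ι 2 ℚ.≤ eSum i) (ℕ.+-comm k 1)
  (ℚ.≤-trans (ℚ.≤-reflexive (ι-def 2)) (eSum-mono 1 k))

-- The choice of `p`, for a rational upper bound `t` of D^(1 + 1/k).

module _ {n D : ℕ} (k : ℕ) .{{_ : NonZero k}} (G : SimpleGraph n)
         (∣N∣≤D : ∀ v → ∣ N[_] G v ∣ ≤ D) (k≤D : k ≤ D)
         {t : ℚ} (D≤t : ι D ℚ.≤ t) (D^[k+1]≤t^k : ι D ^ suc k ℚ.≤ t ^ k) where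

  private
    c s p : ℚ
    c = eSum k
    s = c ℚ.* t
    -- p − C(D, k + 1) pᵏ⁺¹ is maximal at p = ((k + 1) C(D, k + 1))^(− 1 / k); the
    -- rational (k + 1) / (c t) is below that point.
    p = ι (suc k) ℚ.* recip s

    0≤c : 0ℚ ℚ.≤ c
    0≤c = ℚ.<⇒≤ (0<eSum k)

    k≤t : ι k ℚ.≤ t
    k≤t = ℚ.≤-trans (ι-mono-≤ k≤D) D≤t

    0<t : 0ℚ ℚ.< t
    0<t = ℚ.<-≤-trans (0<ι k) k≤t

    0<s : 0ℚ ℚ.< s
    0<s = *-pos {c} {t} (0<eSum k) 0<t

    sp≡1+k : s ℚ.* p ≡ ι (suc k)
    sp≡1+k = trans
      (solve 3 (λ s a r → s :* (a :* r) := a :* (s :* r)) refl s (ι (suc k)) (recip s))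
      (trans (cong (ι (suc k) ℚ.*_) (recip-inverseʳ {s} 0<s)) (ℚ.*-identityʳ (ι (suc k))))

    0≤p : 0ℚ ℚ.≤ p
    0≤p = *-nonNeg {ι (suc k)} {recip s} (0≤ι (suc k)) (ℚ.<⇒≤ (0<recip {s} 0<s))

    -- The chain k + 1 ≤ 2 k ≤ c t rests on 1 ≤ k, 2 ≤ c and k ≤ D ≤ t.
    p≤1 : p ℚ.≤ 1ℚ
    p≤1 = *-cancelˡ-≤ s {p} {1ℚ} 0<s (begin
      s ℚ.* p           ≡⟨ sp≡1+k ⟩
      ι (suc k)         ≤⟨ ι-mono-≤ (ℕ.≤-trans (ℕ.+-monoˡ-≤ k (ℕ.>-nonZero⁻¹ k))
                             (ℕ.+-monoʳ-≤ k (ℕ.m≤m+n k 0))) ⟩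
      ι (2 * k)         ≡⟨ ι-homo-* 2 k ⟩
      ι 2 ℚ.* ι k       ≤⟨ *-mono-≤-nonNeg {ι 2} {c} {ι k} {t} (0≤ι k) 0≤c (ι2≤eSum k) k≤t ⟩
      s                 ≡⟨ ℚ.*-identityʳ s ⟨
      s ℚ.* 1ℚ          ∎)
      where open ℚ.≤-Reasoning

    b : ℚ
    b = ι (D C suc k)

    -- The expected loss per neighbourhood, `b` pᵏ⁺¹, is thus at most p / (k + 1). After scaling by
    -- `s ^ k`, the bound (k + 1)ᵏ ≤ k! cᵏ completes (k + 1)!, and C(D, k + 1) (k + 1)! ≤ Dᵏ⁺¹ ≤ tᵏ
    -- finishes.
    [1+k]bp^k≤1 : ι (suc k) ℚ.* (b ℚ.* p ^ k) ℚ.≤ 1ℚ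
    [1+k]bp^k≤1 = *-cancelˡ-≤ (s ^ k) (^-pos {s} k 0<s) (begin
      s ^ k ℚ.* (ι (suc k) ℚ.* (b ℚ.* p ^ k))
        ≡⟨ solve 4 (λ x a b y → x :* (a :* (b :* y)) := (a :* b) :* (x :* y)) refl
             (s ^ k) (ι (suc k)) b (p ^ k) ⟩
      (ι (suc k) ℚ.* b) ℚ.* (s ^ k ℚ.* p ^ k)
        ≡⟨ cong ((ι (suc k) ℚ.* b) ℚ.*_) (trans (sym (^-distrib-* s p k)) (cong (_^ k) sp≡1+k)) ⟩
      (ι (suc k) ℚ.* b) ℚ.* ι (suc k) ^ k
        ≤⟨ *-monoˡ-≤ (ι (suc k) ℚ.* b) (*-nonNeg (0≤ι (suc k)) (0≤ι (D C suc k)))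
             ([1+k]^k≤k!*eSum^k k) ⟩
      (ι (suc k) ℚ.* b) ℚ.* (ι (k !) ℚ.* c ^ k)
        ≡⟨ solve 4 (λ a b f y → (a :* b) :* (f :* y) := (b :* (a :* f)) :* y) refl
             (ι (suc k)) b (ι (k !)) (c ^ k) ⟩
      (b ℚ.* (ι (suc k) ℚ.* ι (k !))) ℚ.* c ^ k
        ≡⟨ cong (ℚ._* c ^ k) (trans (ι-homo-* (D C suc k) (suc k !))
             (cong (b ℚ.*_) (ι-homo-* (suc k) (k !)))) ⟨
      ι ((D C suc k) * suc k !) ℚ.* c ^ k
        ≤⟨ *-monoʳ-≤ (c ^ k) (^-nonNeg k 0≤c) (ℚ.≤-trans (ι-mono-≤ (nCk*k!≤n^k D (suc k)))
             (ℚ.≤-trans (ℚ.≤-reflexive (ι-homo-^ D (suc k))) D^[k+1]≤t^k)) ⟩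
      t ^ k ℚ.* c ^ k
        ≡⟨ trans (ℚ.*-comm (t ^ k) (c ^ k)) (sym (^-distrib-* c t k)) ⟩
      s ^ k
        ≡⟨ ℚ.*-identityʳ (s ^ k) ⟨
      s ^ k ℚ.* 1ℚ ∎)
      where open ℚ.≤-Reasoning

  -- Scaling the averaged bound by `s` turns the gain n p into n (k + 1) and the loss into at most
  -- n; cancelling n leaves n k.
  nk≤L*eSum*t : ι n ℚ.* ι k ℚ.≤ ι (L k G) ℚ.* (eSum k ℚ.* t)
  nk≤L*eSum*t = +-cancelˡ-≤ (ι n) (begin
    ι n ℚ.+ ι n ℚ.* ι k
      ≡⟨ solve 2 (λ n k → n :+ n :* k := n :* (con 1ℚ :+ k)) refl (ι n) (ι k) ⟩
    ι n ℚ.* (1ℚ ℚ.+ ι k)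
      ≡⟨ cong (ι n ℚ.*_) (trans sp≡1+k (ι-suc k)) ⟨
    ι n ℚ.* (s ℚ.* p)
      ≡⟨ solve 3 (λ n s p → n :* (s :* p) := s :* (n :* p)) refl (ι n) s p ⟩
    s ℚ.* (ι n ℚ.* p)
      ≤⟨ *-monoˡ-≤ s (ℚ.<⇒≤ 0<s) (np≤L+nCp^[k+1] p 0≤p p≤1 k G ∣N∣≤D) ⟩
    s ℚ.* (l ℚ.+ ι n ℚ.* (b ℚ.* (p ℚ.* p ^ k)))
      ≡⟨ solve 6 (λ s l n b p y →
           s :* (l :+ n :* (b :* (p :* y))) := n :* ((s :* p) :* (b :* y)) :+ l :* s) refl
           s l (ι n) b p (p ^ k) ⟩
    ι n ℚ.* ((s ℚ.* p) ℚ.* (b ℚ.* p ^ k)) ℚ.+ l ℚ.* s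
      ≡⟨ cong (λ a → ι n ℚ.* (a ℚ.* (b ℚ.* p ^ k)) ℚ.+ l ℚ.* s) sp≡1+k ⟩
    ι n ℚ.* (ι (suc k) ℚ.* (b ℚ.* p ^ k)) ℚ.+ l ℚ.* s
      ≤⟨ ℚ.+-monoˡ-≤ (l ℚ.* s) (*-monoˡ-≤ (ι n) (0≤ι n) [1+k]bp^k≤1) ⟩
    ι n ℚ.* 1ℚ ℚ.+ l ℚ.* s
      ≡⟨ cong (ℚ._+ l ℚ.* s) (ℚ.*-identityʳ (ι n)) ⟩
    ι n ℚ.+ l ℚ.* s ∎)
    where
    open ℚ.≤-Reasoning
    l = ι (L k G)

-- Rational upper approximations of the root.

module _ (y q : ℕ) .{{_ : NonZero q}} (m : ℕ) where

  private
    r : ℕ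
    r = ⌈root⌉ q (y * suc m ℕ.^ q)

  ι≤rootSeq : ∀ a → a ℕ.^ q ≤ y → ι a ℚ.≤ rootSeq y q m
  ι≤rootSeq a a^q≤y = ι-≤-/ a r (suc m) (^-cancelˡ-≤ q (begin
    (a * suc m) ℕ.^ q         ≡⟨ ^-distribʳ-* q a (suc m) ⟩
    a ℕ.^ q * suc m ℕ.^ q     ≤⟨ ℕ.*-monoˡ-≤ (suc m ℕ.^ q) a^q≤y ⟩
    y * suc m ℕ.^ q           ≤⟨ ⌈root⌉-upper q (y * suc m ℕ.^ q) ⟩
    r ℕ.^ q                   ∎))
    where open ℕ.≤-Reasoning

  -- The numerators are rounded up, so each single term bounds the root from above and can serve as
  -- `t`.
  ι≤rootSeq^q : ι y ℚ.≤ rootSeq y q m ^ q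
  ι≤rootSeq^q = *-cancelˡ-≤ (d ^ q) (^-pos {d} q (0<ι (suc m))) (begin
    d ^ q ℚ.* ι y               ≡⟨ ℚ.*-comm (d ^ q) (ι y) ⟩
    ι y ℚ.* d ^ q               ≡⟨ cong (ι y ℚ.*_) (ι-homo-^ (suc m) q) ⟨
    ι y ℚ.* ι (suc m ℕ.^ q)     ≡⟨ ι-homo-* y (suc m ℕ.^ q) ⟨
    ι (y * suc m ℕ.^ q)         ≤⟨ ι-mono-≤ (⌈root⌉-upper q (y * suc m ℕ.^ q)) ⟩
    ι (r ℕ.^ q)                 ≡⟨ ι-homo-^ r q ⟩
    ι r ^ q                     ≡⟨ cong (_^ q) (a/b*b≡a r (suc m)) ⟨
    (rootSeq y q m ℚ.* d) ^ q   ≡⟨ ^-distrib-* (rootSeq y q m) d q ⟩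
    rootSeq y q m ^ q ℚ.* d ^ q ≡⟨ ℚ.*-comm (rootSeq y q m ^ q) (d ^ q) ⟩
    d ^ q ℚ.* rootSeq y q m ^ q ∎)
    where
    open ℚ.≤-Reasoning
    d = ι (suc m)

-- The rational bound is applied at every term of the root sequence with the partial sum `eSum k`
-- kept fixed. Later partial sums in the denominator exceed it by a fixed factor, which gives a gap
-- uniform in the index.
corollary1 : ∀ {n : ℕ} (k : ℕ) .{{_ : NonZero k}} (G : SimpleGraph n) (Δ : ℕ) →
    HasMaxDegree G Δ → k ≤ 1 + Δ →
    fromℕ (k * n) ÷ℝ (e *⁺ (1 + Δ) ^[ k + 1 / k ]) <ℝ fromℕ (L k G)
corollary1 {n} k G Δ ((v , _) , degree≤) k≤D = record
  -- From index `suc k` on the quotient is at most l c / c′; this is what remains of `l`.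
  { ε   = l ℚ.* (1ℚ ℚ.- c ℚ.* r)
  ; 0<ε = *-pos {l} {1ℚ ℚ.- c ℚ.* r} 0<l
      (subst (ℚ._< 1ℚ ℚ.- c ℚ.* r) (ℚ.+-inverseʳ (c ℚ.* r)) (ℚ.+-monoˡ-< (ℚ.- (c ℚ.* r)) cr<1))
  ; N   = suc k
  ; gap = gap
  }
  where
  D = 1 + Δ
  y = D ℕ.^ (k + 1)
  l = ι (L k G)
  -- c < c′ ≤ e: the slack between them makes the bound strict.
  c = eSum k
  c′ = eSum (suc k)
  r = recip c′

  t : ℕ → ℚ
  t = rootSeq y k

  instance
    y≢0 : NonZero y
    y≢0 = ℕ.m^n≢0 D (k + 1)

  0<t : ∀ m → 0ℚ ℚ.< t m
  0<t m = ℚ.<-≤-trans (ℚ.positive⁻¹ 1ℚ) (1≤rootSeq y k m)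

  kn≤lct : ∀ m → ι (k * n) ℚ.≤ l ℚ.* (c ℚ.* t m)
  kn≤lct m = subst (ℚ._≤ l ℚ.* (c ℚ.* t m))
    (trans (ℚ.*-comm (ι n) (ι k)) (sym (ι-homo-* k n)))
    (nk≤L*eSum*t k G
      (λ u → ℕ.≤-trans (∣N[v]∣≤1+degree G u) (s≤s (degree≤ (u , refl)))) k≤D
      -- `D ≤ t m` follows from Dᵏ ≤ Dᵏ⁺¹.
      (ι≤rootSeq y k m D (ℕ.^-monoʳ-≤ D (ℕ.m≤m+n k 1)))
      (subst (ℚ._≤ t m ^ k) (trans (cong (λ i → ι (D ℕ.^ i)) (ℕ.+-comm k 1)) (ι-homo-^ D (suc k)))
        (ι≤rootSeq^q y k m)))

  0<kn : 0ℚ ℚ.< ι (k * n)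
  -- The vertex that attains the maximum degree witnesses that `n` is nonzero.
  0<kn = 0<ι (k * n) {{ℕ.m*n≢0 k n {{it}} {{nonZeroIndex v}}}}

  -- The gap is proportional to `l`. The bound at index 0 already forces positivity.
  0<l : 0ℚ ℚ.< l
  0<l = ℚ.*-cancelʳ-<-nonNeg (c ℚ.* t 0)
    {{ℚ.nonNegative (ℚ.<⇒≤ (*-pos {c} {t 0} (0<eSum k) (0<t 0)))}}
    (subst (ℚ._< l ℚ.* (c ℚ.* t 0)) (sym (ℚ.*-zeroˡ (c ℚ.* t 0))) (ℚ.<-≤-trans 0<kn (kn≤lct 0)))

  c′r≡1 : c′ ℚ.* r ≡ 1ℚ
  c′r≡1 = recip-inverseʳ {c′} (0<eSum (suc k))

  0<r : 0ℚ ℚ.< r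
  0<r = 0<recip {c′} (0<eSum (suc k))

  cr<1 : c ℚ.* r ℚ.< 1ℚ
  cr<1 = subst (c ℚ.* r ℚ.<_) c′r≡1
    (ℚ.*-monoˡ-<-pos r {{ℚ.positive 0<r}} (eSum-<-suc k))

  -- The numerator is at most l c t and the denominator at least c′ t at the same index, so the root
  -- term cancels.
  quotient≤lcr : ∀ {m} → suc k ≤ m →
                 ι (k * n) ℚ.* recip (eSum m ℚ.* t m) ℚ.≤ l ℚ.* (c ℚ.* r)
  quotient≤lcr {m} k<m = *-cancelˡ-≤ u 0<u (begin
    u ℚ.* (ι (k * n) ℚ.* recip u)
      ≡⟨ solve 3 (λ u a r → u :* (a :* r) := a :* (u :* r)) refl u (ι (k * n)) (recip u) ⟩
    ι (k * n) ℚ.* (u ℚ.* recip u)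
      ≡⟨ trans (cong (ι (k * n) ℚ.*_) (recip-inverseʳ {u} 0<u)) (ℚ.*-identityʳ (ι (k * n))) ⟩
    ι (k * n)
      ≤⟨ kn≤lct m ⟩
    l ℚ.* (c ℚ.* t m)
      ≡⟨ trans (cong (ℚ._* (l ℚ.* (c ℚ.* t m))) c′r≡1) (ℚ.*-identityˡ (l ℚ.* (c ℚ.* t m))) ⟨
    (c′ ℚ.* r) ℚ.* (l ℚ.* (c ℚ.* t m))
      ≡⟨ solve 5 (λ c′ r l c t → (c′ :* r) :* (l :* (c :* t)) := (c′ :* t) :* (l :* (c :* r)))
           refl c′ r l c (t m) ⟩
    (c′ ℚ.* t m) ℚ.* (l ℚ.* (c ℚ.* r))
      ≤⟨ *-monoʳ-≤ (l ℚ.* (c ℚ.* r)) (*-nonNeg {l} {c ℚ.* r} (ℚ.<⇒≤ 0<l)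
           (*-nonNeg {c} {r} (ℚ.<⇒≤ (0<eSum k)) (ℚ.<⇒≤ 0<r)))
           (*-monoʳ-≤ (t m) (ℚ.<⇒≤ (0<t m)) (eSum-mono-≤ k<m)) ⟩
    u ℚ.* (l ℚ.* (c ℚ.* r)) ∎)
    where
    open ℚ.≤-Reasoning
    u = eSum m ℚ.* t m
    0<u : 0ℚ ℚ.< u
    0<u = *-pos {eSum m} {t m} (0<eSum m) (0<t m)

  gap : ∀ {m} → suc k ≤ m →
        (+ (k * n) / 1) ℚ.* recip (eSum m ℚ.* t m) ℚ.+ l ℚ.* (1ℚ ℚ.- c ℚ.* r) ℚ.≤ + L k G / 1
  gap {m} k<m = begin
    (+ (k * n) / 1) ℚ.* recip (eSum m ℚ.* t m) ℚ.+ l ℚ.* (1ℚ ℚ.- c ℚ.* r)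
      ≡⟨ cong (λ a → a ℚ.* recip (eSum m ℚ.* t m) ℚ.+ l ℚ.* (1ℚ ℚ.- c ℚ.* r)) (ι-def (k * n)) ⟨
    ι (k * n) ℚ.* recip (eSum m ℚ.* t m) ℚ.+ l ℚ.* (1ℚ ℚ.- c ℚ.* r)
      ≤⟨ ℚ.+-monoˡ-≤ (l ℚ.* (1ℚ ℚ.- c ℚ.* r)) (quotient≤lcr k<m) ⟩
    l ℚ.* (c ℚ.* r) ℚ.+ l ℚ.* (1ℚ ℚ.- c ℚ.* r)
      ≡⟨ solve 2 (λ l x → l :* x :+ l :* (con 1ℚ :- x) := l) refl l (c ℚ.* r) ⟩
    l
      ≡⟨ ι-def (L k G) ⟩
    + L k G / 1 ∎
    where open ℚ.≤-Reasoning
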